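{- For every $n\ge1$ and every $\sigma\in S_n(123)$ (permutations of $[n]$ with no increasing subsequence of length $3$), $\mu(\sigma)=L'(\lambda(\sigma))$.
   Context: Dyck path of semilength $n$: lattice path from $(0,0)$ to $(2n,0)$ with steps $U=(1,1)$, $D=(1,-1)$, never below the $x$-axis. A return is a down step ending on the $x$-axis; a Dyck path is irreducible if it has exactly one return; every Dyck path $P$ factors uniquely as $P=P_1\cdots P_r$ with each $P_i$ irreducible (its irreducible components). If $P$ has ascents (maximal runs of $U$) of lengths $a_1,\dots,a_k$ and descents of lengths $d_1,\dots,d_k$ (left to right), with $A_i=a_1+\dots+a_i$, $D_i=d_1+\dots+d_i$, its ascent-descent code is $(A,D)$ with $A=A_1,\dots,A_{k-1}$, $D=D_1,\dots,D_{k-1}$; this determines $P$. $P$ is irreducible iff $A_i>D_i$ for all $i$. The map $L'$: for an irreducible path $P$ of semilength $n$ with code $A=A_1,\dots,A_h$, $D=D_1,\dots,D_h$, let $\{\hat A_1>\dots>\hat A_{n-2-h}\}=\{1,\dots,n-2\}\setminus\{A_1-1,\dots,A_h-1\}$ and $\{\hat D_1>\dots>\hat D_{n-2-h}\}=\{1,\dots,n-2\}\setminus\{D_1,\dots,D_h\}$; $L'(P)$ is the (irreducible) Dyck path of semilength $n$ with code $A'_i=n-\hat A_i$, $D'_i=n-1-\hat D_i$. For a general Dyck path with irreducible components $P_1\cdots P_r$, $L'(P_1\cdots P_r)=L'(P_r)\cdots L'(P_1)$; $L'$ of the empty path is empty. (This is the paper's variant of the Kreweras–Lalanne involution: reflect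 $P$ in a vertical line and replace each irreducible component $UXD$ by $U\,L(X)\,D$, $L$ the Kreweras–Lalanne involution.) For $\sigma=x_1\cdots x_n$: $x_i$ is a left-to-right (LTR) minimum if $x_i<x_j$ for all $j<i$; $x_i$ is a right-to-left (RTL) maximum if $x_i>x_j$ for all $j>i$. $\lambda(\sigma)$: write $\sigma=m_1w_1\cdots m_kw_k$ with $m_1>\dots>m_k$ the LTR minima and $w_i$ possibly empty words, $m_0=n+1$; $\lambda(\sigma)=U^{m_0-m_1}D^{|w_1|+1}\cdots U^{m_{k-1}-m_k}D^{|w_k|+1}$. $\mu(\sigma)$: write $\sigma=u_hM_h\cdots u_1M_1$ with $M_1<\dots<M_h$ the RTL maxima and $u_i$ possibly empty words, $M_0=0$; $\mu(\sigma)=U^{M_1-M_0}D^{|u_1|+1}U^{M_2-M_1}D^{|u_2|+1}\cdots U^{M_h-M_{h-1}}D^{|u_h|+1}$. -}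

module Defs where

open import Data.Bool using (if_then_else_)
open import Data.Fin using (Fin; toℕ; _<_)
open import Data.Fin.Permutation using (Permutation′; _⟨$⟩ʳ_)
open import Data.List
  using (List; []; _∷_; [_]; _++_; map; concat; concatMap; length; filter;
         replicate; reverse; tabulate; zipWith; applyDownFrom)
open import Data.List.Relation.Unary.All using (all?)
open import Data.Nat using (ℕ; zero; suc; _+_; _∸_; _<?_; _≟_)
open import Data.List.Membership.DecPropositional _≟_ using (_∉?_)
open import Data.Product using (_×_; _,_; proj₁; proj₂)
open import Relation.Binary using (DecidableEquality)
open import Relation.Binary.PropositionalEquality using (refl)
open import Relation.Nullary using (¬_; yes; no; does)

Avoids123 : ∀ {n} → Permutation′ n → Set
Avoids123 {n} σ = (i j k : Fin n) → i < j → j < k →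
  ¬ ((σ ⟨$⟩ʳ i) < (σ ⟨$⟩ʳ j) × (σ ⟨$⟩ʳ j) < (σ ⟨$⟩ʳ k))

-- x₁ ⋯ xₙ with letters in {1, …, n}; Fin counts from 0.
oneLine : ∀ {n} → Permutation′ n → List ℕ
oneLine σ = tabulate λ i → suc (toℕ (σ ⟨$⟩ʳ i))

-- U = (1, 1) and D = (1, -1). A path is its word of steps. The operations on
-- paths are defined on all words but are meant for Dyck paths; lambda σ and
-- mu σ are Dyck paths, so the values on other words play no role.

data Step : Set where
  U D : Step

_≟ˢ_ : DecidableEquality Step
U ≟ˢ U = yes refl
U ≟ˢ D = no λ ()
D ≟ˢ U = no λ ()
D ≟ˢ D = yes refl

Path : Set
Path = List Step

-- For a Dyck path, half its length.
semilength : Path → ℕ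
semilength p = length (filter (U ≟ˢ_) p)

consFirst : ∀ {A : Set} → A → List (List A) → List (List A)
consFirst x []         = [ [ x ] ]
consFirst x (xs ∷ xss) = (x ∷ xs) ∷ xss

-- componentsFrom h p cuts p, started at height h, after each return.
componentsFrom : ℕ → Path → List Path
componentsFrom h             []      = []
componentsFrom h             (U ∷ p) = consFirst U (componentsFrom (suc h) p)
componentsFrom (suc zero)    (D ∷ p) = [ D ] ∷ componentsFrom zero p
componentsFrom (suc (suc h)) (D ∷ p) = consFirst D (componentsFrom (suc h) p)
componentsFrom zero          (D ∷ p) = consFirst D (componentsFrom zero p) -- below the axis: not a Dyck path

components : Path → List Path
components = componentsFrom 0

consPositive : ℕ → List ℕ → List ℕ
consPositive zero    ks = ks
consPositive (suc k) ks = suc k ∷ ks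

-- The lengths of the maximal runs of s in p, where k letters s have
-- already been read immediately before p.
runsFrom : ℕ → Step → Path → List ℕ
runsFrom k s []      = consPositive k []
runsFrom k s (t ∷ p) =
  if does (s ≟ˢ t) then runsFrom (suc k) s p else consPositive k (runsFrom 0 s p)

ascents descents : Path → List ℕ
ascents  = runsFrom 0 U
descents = runsFrom 0 D

-- The partial sums  c + a₁ + ⋯ + aᵢ  for 1 ≤ i ≤ k - 1: the last is left out.
properSums : ℕ → List ℕ → List ℕ
properSums c []           = []
properSums c (a ∷ [])     = []
properSums c (a ∷ b ∷ as) = (c + a) ∷ properSums (c + a) (b ∷ as)

code : Path → List ℕ × List ℕ
code p = properSums 0 (ascents p) , properSums 0 (descents p)

-- differences c n (A₁ ⋯ Aₕ) = A₁ - c, A₂ - A₁, …, n - Aₕ.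
differences : ℕ → ℕ → List ℕ → List ℕ
differences c n []       = [ n ∸ c ]
differences c n (a ∷ as) = (a ∸ c) ∷ differences a n as

-- The path of semilength n with the given code.
decode : ℕ → List ℕ × List ℕ → Path
decode n (as , ds) =
  concat (zipWith (λ a d → replicate a U ++ replicate d D)
                  (differences 0 n as) (differences 0 n ds))

-- {1, …, n - 2} ∖ xs, in decreasing order.
complement : ℕ → List ℕ → List ℕ
complement n xs = filter (_∉? xs) (applyDownFrom suc (n ∸ 2))

-- Applied to the irreducible components only. The i-th entries of Â and D̂ are
-- the i-th largest elements of the complements, so both lists of the new code
-- are increasing, and no subtraction truncates.
L′-irreducible : Path → Path
L′-irreducible p = decode n (map (n ∸_) Â , map (n ∸ 1 ∸_) D̂)
  where
  n = semilength p
  Â = complement n (map (_∸ 1) (proj₁ (code p)))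
  D̂ = complement n (proj₂ (code p))

L′ : Path → Path
L′ p = concatMap L′-irreducible (reverse (components p))

-- For a word  v x₁ x₂ ⋯  with the letters of v listed in `seen`, factor
-- x₁ x₂ ⋯ = w₀ m₁ w₁ ⋯ mₖ wₖ  at the left-to-right minima mᵢ of the whole
-- word, giving w₀ and the (mᵢ , wᵢ). If v is empty then so is w₀.
ltrMinFactorsFrom : List ℕ → List ℕ → List ℕ × List (ℕ × List ℕ)
ltrMinFactorsFrom seen []       = [] , []
ltrMinFactorsFrom seen (x ∷ xs) with ltrMinFactorsFrom (x ∷ seen) xs
... | w , mws =
  if does (all? (x <?_) seen) then ([] , (x , w) ∷ mws) else (x ∷ w , mws)

-- σ = m₁ w₁ ⋯ mₖ wₖ  as  (m₁ , w₁) ∷ ⋯ ∷ (mₖ , wₖ) ∷ [].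
ltrMinFactors : List ℕ → List (ℕ × List ℕ)
ltrMinFactors xs = proj₂ (ltrMinFactorsFrom [] xs)

consWord : ℕ → List (List ℕ × ℕ) → List (List ℕ × ℕ)
consWord x []               = []
consWord x ((u , M) ∷ uMs) = (x ∷ u , M) ∷ uMs

-- σ = uₕ Mₕ ⋯ u₁ M₁  as  (uₕ , Mₕ) ∷ ⋯ ∷ (u₁ , M₁) ∷ [].
rtlMaxFactors : List ℕ → List (List ℕ × ℕ)
rtlMaxFactors []       = []
rtlMaxFactors (x ∷ xs) =
  if does (all? (_<? x) xs)
  then ([] , x) ∷ rtlMaxFactors xs
  else consWord x (rtlMaxFactors xs)

lambdaFrom : ℕ → List (ℕ × List ℕ) → Path
lambdaFrom m₀ []              = []
lambdaFrom m₀ ((m , w) ∷ mws) =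
  replicate (m₀ ∸ m) U ++ replicate (length w + 1) D ++ lambdaFrom m mws

-- The map λ, a reserved symbol.
lambda : ∀ {n} → Permutation′ n → Path
lambda {n} σ = lambdaFrom (n + 1) (ltrMinFactors (oneLine σ))

muFrom : ℕ → List (List ℕ × ℕ) → Path
muFrom M₀ []              = []
muFrom M₀ ((u , M) ∷ uMs) =
  replicate (M ∸ M₀) U ++ replicate (length u + 1) D ++ muFrom M uMs

mu : ∀ {n} → Permutation′ n → Path
mu σ = muFrom 0 (reverse (rtlMaxFactors (oneLine σ)))

{-# OPTIONS --safe #-}
module Submission where

-- Reversing and complementing σ turns right-to-left maxima into left-to-right
-- minima, so μ(σ) = λ(rc σ), and the theorem compares the λ-codes of σ and rc σ.
-- A return of λ(σ) is a decomposition σ = γ ⊖ δ as a skew sum, which rc turns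
-- into rc δ ⊖ rc γ, so both sides factor over the skew components of σ in
-- opposite orders. In a skew-indecomposable σ of length at least 2 no letter is
-- both a left-to-right minimum and a right-to-left maximum, and avoiding 123
-- means that every letter is one of the two. Hence the values (and likewise the
-- positions) of the maxima are the complement of those of the minima, which is
-- what L′ computes.

open import Defs
open import Data.Fin using (Fin; zero; suc)
import Data.Fin as Fin
open import Data.Fin.Permutation using (Permutation′; _⟨$⟩ʳ_; _⟨$⟩ˡ_; inverseˡ)
open import Data.Fin.Properties using (toℕ-injective; toℕ<n)
open import Data.List
  using (List; []; _∷_; [_]; _++_; map; concat; concatMap; foldl; foldr; length;
         replicate; reverse; zipWith; tabulate; take; drop; applyDownFrom)
open import Data.List.Membership.Propositional using (_∈_; _∉_; find; lose)
open import Data.List.Membership.Propositional.Properties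
  using (∈-++⁺ˡ; ∈-++⁺ʳ; ∈-++⁻; ∈-map⁺; ∈-map⁻; ∈-filter⁺; ∈-filter⁻; ∈-applyDownFrom⁺;
         ∈-applyDownFrom⁻; ∈-∃++; ∈-tabulate⁻)
open import Data.List.Properties
  using (++-assoc; ++-identityʳ; length-++; take++drop≡id; unfold-reverse; foldl-∷ʳ; concatMap-++;
         length-tabulate; length-take; ∷-injective; ∷-injectiveˡ; ∷-injectiveʳ)
open import Data.List.Relation.Unary.All as All using (All; []; _∷_; all?)
open import Data.List.Relation.Unary.All.Properties as All using (¬All⇒Any¬; ¬Any⇒All¬; ++⁺; ++⁻ˡ; ++⁻ʳ)
open import Data.List.Relation.Unary.AllPairs as AllPairs using (AllPairs; []; _∷_)
import Data.List.Relation.Unary.AllPairs.Properties as AllPairs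
open import Data.List.Relation.Unary.Any using (Any; here; there)
open import Data.List.Relation.Unary.Unique.Propositional using (Unique)
import Data.List.Relation.Unary.Unique.Propositional.Properties as Unique
open import Data.Nat
  using (ℕ; zero; suc; _+_; _∸_; _⊓_; _⊔_; _≤_; _<_; s≤s; z≤n; _≤?_; _<?_; _≟_)
open import Data.List.Membership.DecPropositional _≟_ using (_∈?_; _∉?_)
open import Data.Nat.Properties hiding (_≤?_; _<?_; _≟_)
open import Data.Product using (_×_; _,_; ∃; ∃₂; proj₁; proj₂)
open import Data.Sum using (_⊎_; inj₁; inj₂)
open import Data.Unit using (⊤)
open import Relation.Binary.PropositionalEquality
  using (_≡_; _≢_; refl; sym; trans; cong; cong₂; subst; subst₂; module ≡-Reasoning)
open import Relation.Nullary using (¬_; yes; no; contradiction)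

-- The skew components of σ are words on intervals of values, not on initial segments. Nothing is
-- standardised: statements concern words on {b + 1, ..., b + n}, and one constant `K`, fixed
-- throughout, reflects `x` to `K ∸ x`, so that the reflection of a component is literally a factor
-- of the reflection of the word. Paths concatenate along with words once the running minimum is
-- carried along; a word on the interval starts from `suc (b + n)`.
--
-- The constants of L′ come from the extreme letters of an indecomposable word of length n ≥ 2. Its
-- code records each minimum v but the last through A - 1 = b + n - v, and each minimum but the
-- first through the number D of letters before it. The value b + 1 and position 0 belong to minima,
-- b + n and position n - 1 to maxima, so the codes of the word and of its reflection share the n -
-- 2 other values and the n - 2 other positions, all numbered 1, ..., n - 2. Reflection sends value
-- number a to the entry n - a and position d to n - 1 - d.

private variable
  A : Set

-- The path of a word, read letter by letter

replicate-+ : ∀ j k (x : A) → replicate (j + k) x ≡ replicate j x ++ replicate k x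
replicate-+ zero    k x = refl
replicate-+ (suc j) k x = cong (x ∷_) (replicate-+ j k x)

-- λ read letter by letter, m being the minimum so far; a letter above m leaves
-- no U, the subtraction being truncated.
minimaPath : ℕ → List ℕ → Path
minimaPath m []       = []
minimaPath m (x ∷ xs) = replicate (m ∸ x) U ++ D ∷ minimaPath (m ⊓ x) xs

minimum : ℕ → List ℕ → ℕ
minimum = foldl _⊓_

minimaPath-++ : ∀ m xs ys → minimaPath m (xs ++ ys) ≡ minimaPath m xs ++ minimaPath (minimum m xs) ys
minimaPath-++ m []       ys = refl
minimaPath-++ m (x ∷ xs) ys = begin
  replicate (m ∸ x) U ++ D ∷ minimaPath (m ⊓ x) (xs ++ ys)
    ≡⟨ cong (λ p → replicate (m ∸ x) U ++ D ∷ p) (minimaPath-++ (m ⊓ x) xs ys) ⟩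
  replicate (m ∸ x) U ++ (D ∷ minimaPath (m ⊓ x) xs) ++ minimaPath (minimum m (x ∷ xs)) ys
    ≡⟨ ++-assoc (replicate (m ∸ x) U) _ _ ⟨
  minimaPath m (x ∷ xs) ++ minimaPath (minimum m (x ∷ xs)) ys ∎
  where open ≡-Reasoning

semilength-ups : ∀ k p → semilength (replicate k U ++ p) ≡ k + semilength p
semilength-ups zero    p = refl
semilength-ups (suc k) p = cong suc (semilength-ups k p)

m∸x+m⊓x≡m : ∀ m x → (m ∸ x) + (m ⊓ x) ≡ m
m∸x+m⊓x≡m m x = begin
  (m ∸ x) + (m ⊓ x)  ≡⟨ cong ((m ∸ x) +_) (⊓-comm m x) ⟩
  (m ∸ x) + (x ⊓ m)  ≡⟨ +-comm (m ∸ x) _ ⟩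
  (x ⊓ m) + (m ∸ x)  ≡⟨ m⊓n+n∸m≡n x m ⟩
  m                  ∎
  where open ≡-Reasoning

semilength-minimaPath : ∀ m xs → semilength (minimaPath m xs) + minimum m xs ≡ m
semilength-minimaPath m []       = refl
semilength-minimaPath m (x ∷ xs) = begin
  semilength (minimaPath m (x ∷ xs)) + minimum m (x ∷ xs)
    ≡⟨ cong (_+ minimum m (x ∷ xs)) (semilength-ups (m ∸ x) _) ⟩
  (m ∸ x) + semilength (minimaPath (m ⊓ x) xs) + minimum m (x ∷ xs)
    ≡⟨ +-assoc (m ∸ x) _ _ ⟩
  (m ∸ x) + (semilength (minimaPath (m ⊓ x) xs) + minimum m (x ∷ xs))
    ≡⟨ cong ((m ∸ x) +_) (semilength-minimaPath (m ⊓ x) xs) ⟩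
  (m ∸ x) + (m ⊓ x)
    ≡⟨ m∸x+m⊓x≡m m x ⟩
  m ∎
  where open ≡-Reasoning

-- The ascent-descent code of a path of minima

-- In a word read with current minimum m, the values of the successive minima,
-- starting with m itself and leaving out the last one.
formerMinima : ℕ → List ℕ → List ℕ
formerMinima m []       = []
formerMinima m (x ∷ xs) with x <? m
... | yes _ = m ∷ formerMinima x xs
... | no  _ = formerMinima m xs

-- Each letter leaves exactly one D, so a new minimum with `i` letters before it starts an ascent
-- after `i` down steps: `i` is a partial sum of descents.
minimaPositions : ℕ → ℕ → List ℕ → List ℕ
minimaPositions m i []       = []
minimaPositions m i (x ∷ xs) with x <? m
... | yes _ = i ∷ minimaPositions x (suc i) xs
... | no  _ = minimaPositions m (suc i) xs

-- The two lists are staggered: entries with the same index come from the value of one minimum and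
-- the position of the next.
minimaCode : ℕ → ℕ → List ℕ → List ℕ × List ℕ
minimaCode m x xs = map (m ∸_) (formerMinima x xs) , minimaPositions x 1 xs

runsU-ups : ∀ k j p → runsFrom k U (replicate j U ++ p) ≡ runsFrom (k + j) U p
runsU-ups k zero    p = cong (λ i → runsFrom i U p) (sym (+-identityʳ k))
runsU-ups k (suc j) p = trans (runsU-ups (suc k) j p) (cong (λ i → runsFrom i U p) (sym (+-suc k j)))

runsD-ups : ∀ j p → runsFrom 0 D (replicate j U ++ p) ≡ runsFrom 0 D p
runsD-ups zero    p = refl
runsD-ups (suc j) p = runsD-ups j p

-- The open run already has a letter, so a further descent follows `a` and its sum is not the one
-- left out.
properSums-runsD : ∀ c a k p →
  properSums c (a ∷ runsFrom (suc k) D p) ≡ (c + a) ∷ properSums (c + a) (runsFrom (suc k) D p)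
properSums-runsD c a k []      = refl
properSums-runsD c a k (U ∷ p) = refl
properSums-runsD c a k (D ∷ p) = properSums-runsD c a (suc k) p

∸-positive : ∀ {m x} → x < m → ∃ λ j → m ∸ x ≡ suc j
∸-positive {suc m} {zero}  _         = m , refl
∸-positive {suc m} {suc x} (s≤s x<m) = ∸-positive x<m

∸-split : ∀ {N m x} → x ≤ m → m ≤ N → (N ∸ m) + (m ∸ x) ≡ N ∸ x
∸-split {N} {m} {x} x≤m m≤N = begin
  (N ∸ m) + (m ∸ x)  ≡⟨ +-∸-assoc (N ∸ m) x≤m ⟨
  (N ∸ m) + m ∸ x    ≡⟨ cong (_∸ x) (m∸n+n≡m m≤N) ⟩
  N ∸ x              ∎
  where open ≡-Reasoning

-- The number of U's read so far is `c + a`, with `a` the latest ascent. Its sum is emitted only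
-- when a smaller letter shows that another ascent follows, which is why the last minimum is missing
-- on the right.
properSums-ascents : ∀ {N m} c a xs → c + a ≡ N ∸ m → m ≤ N →
  properSums c (a ∷ runsFrom 0 U (minimaPath m xs)) ≡ map (N ∸_) (formerMinima m xs)
properSums-ascents c a [] eq m≤N = refl
properSums-ascents {N} {m} c a (x ∷ xs) eq m≤N with x <? m
... | no x≮m rewrite m≤n⇒m∸n≡0 (≮⇒≥ x≮m) | m≤n⇒m⊓n≡m (≮⇒≥ x≮m) = properSums-ascents c a xs eq m≤N
... | yes x<m with ∸-positive x<m
...   | j , eq′ rewrite m≥n⇒m⊓n≡n (<⇒≤ x<m) | runsU-ups 0 (m ∸ x) (D ∷ minimaPath x xs) | eq′ =
        cong₂ _∷_ eq (properSums-ascents (c + a) (suc j) xs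
          (trans (cong₂ _+_ eq (sym eq′)) (∸-split (<⇒≤ x<m) m≤N)) (≤-trans (<⇒≤ x<m) m≤N))

properSums-descents : ∀ {m i} e k xs → e + suc k ≡ i →
  properSums e (runsFrom (suc k) D (minimaPath m xs)) ≡ minimaPositions m i xs
properSums-descents e k [] eq = refl
properSums-descents {m} {i} e k (x ∷ xs) eq with x <? m
... | no x≮m rewrite m≤n⇒m∸n≡0 (≮⇒≥ x≮m) | m≤n⇒m⊓n≡m (≮⇒≥ x≮m) =
        properSums-descents e (suc k) xs (trans (+-suc e (suc k)) (cong suc eq))
... | yes x<m with ∸-positive x<m
...   | j , eq′ rewrite m≥n⇒m⊓n≡n (<⇒≤ x<m) | eq′ | runsD-ups j (D ∷ minimaPath x xs) =
        trans (properSums-runsD e (suc k) 0 (minimaPath x xs))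
          (cong₂ _∷_ eq (properSums-descents (e + suc k) 0 xs (trans (+-comm _ 1) (cong suc eq))))

code-minimaPath : ∀ {m} x xs → x < m → code (minimaPath m (x ∷ xs)) ≡ minimaCode m x xs
code-minimaPath {m} x xs x<m with ∸-positive x<m
... | j , eq rewrite m≥n⇒m⊓n≡n (<⇒≤ x<m) | runsU-ups 0 (m ∸ x) (D ∷ minimaPath x xs) | eq
                   | runsD-ups j (D ∷ minimaPath x xs) =
  cong₂ _,_ (properSums-ascents 0 (suc j) xs (sym eq) (<⇒≤ x<m)) (properSums-descents 0 0 xs refl)

block : ℕ → ℕ → Path
block a d = replicate a U ++ replicate d D

decodeFrom : ℕ → ℕ → ℕ → List ℕ → List ℕ → Path
decodeFrom c e n as ds = concat (zipWith block (differences c n as) (differences e n ds))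

-- The block in front is the one still open: `c` and `e` are the entries at which it began, and a
-- letter that is not a minimum lengthens it by one D. The two hypotheses on `n` make the closing
-- entry of `differences` right for both lists.
decode-minimaPathFrom : ∀ {N n m i} c e xs → m ≤ N → c ≤ N ∸ m → e ≤ i →
  N ∸ minimum m xs ≡ n → i + length xs ≡ n →
  decodeFrom c e n (map (N ∸_) (formerMinima m xs)) (minimaPositions m i xs)
    ≡ block (N ∸ m ∸ c) (i ∸ e) ++ minimaPath m xs
decode-minimaPathFrom {N} {n} {m} {i} c e [] m≤N c≤ e≤i refl eq
  rewrite trans (sym eq) (+-identityʳ i) = refl
decode-minimaPathFrom {N} {n} {m} {i} c e (x ∷ xs) m≤N c≤ e≤i min≡ len≡ with x <? m
... | yes x<m rewrite m≥n⇒m⊓n≡n (<⇒≤ x<m) = begin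
  block (N ∸ m ∸ c) (i ∸ e) ++
    decodeFrom (N ∸ m) i n (map (N ∸_) (formerMinima x xs)) (minimaPositions x (suc i) xs)
    ≡⟨ cong (block (N ∸ m ∸ c) (i ∸ e) ++_)
         (decode-minimaPathFrom (N ∸ m) i xs (≤-trans (<⇒≤ x<m) m≤N) (∸-monoʳ-≤ N (<⇒≤ x<m)) (n≤1+n i)
            min≡ (trans (sym (+-suc i (length xs))) len≡)) ⟩
  block (N ∸ m ∸ c) (i ∸ e) ++ block (N ∸ x ∸ (N ∸ m)) (suc i ∸ i) ++ minimaPath x xs
    ≡⟨ cong (block (N ∸ m ∸ c) (i ∸ e) ++_) (cong₂ (λ a d → block a d ++ minimaPath x xs)
         (trans (cong (_∸ (N ∸ m)) (sym (∸-split (<⇒≤ x<m) m≤N))) (m+n∸m≡n (N ∸ m) (m ∸ x)))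
         (m+n∸n≡m 1 i)) ⟩
  block (N ∸ m ∸ c) (i ∸ e) ++ block (m ∸ x) 1 ++ minimaPath x xs
    ≡⟨ cong (block (N ∸ m ∸ c) (i ∸ e) ++_) (++-assoc (replicate (m ∸ x) U) _ _) ⟩
  block (N ∸ m ∸ c) (i ∸ e) ++ replicate (m ∸ x) U ++ D ∷ minimaPath x xs ∎
  where open ≡-Reasoning
... | no x≮m rewrite m≤n⇒m∸n≡0 (≮⇒≥ x≮m) | m≤n⇒m⊓n≡m (≮⇒≥ x≮m) = begin
  decodeFrom c e n (map (N ∸_) (formerMinima m xs)) (minimaPositions m (suc i) xs)
    ≡⟨ decode-minimaPathFrom c e xs m≤N c≤ (m≤n⇒m≤1+n e≤i) min≡ (trans (sym (+-suc i (length xs))) len≡) ⟩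
  block (N ∸ m ∸ c) (suc i ∸ e) ++ minimaPath m xs
    ≡⟨ cong (λ p → (replicate (N ∸ m ∸ c) U ++ p) ++ minimaPath m xs) replicate-suc ⟩
  (replicate (N ∸ m ∸ c) U ++ replicate (i ∸ e) D ++ D ∷ []) ++ minimaPath m xs
    ≡⟨ cong (_++ minimaPath m xs) (sym (++-assoc (replicate (N ∸ m ∸ c) U) (replicate (i ∸ e) D) _)) ⟩
  (block (N ∸ m ∸ c) (i ∸ e) ++ D ∷ []) ++ minimaPath m xs
    ≡⟨ ++-assoc (block (N ∸ m ∸ c) (i ∸ e)) _ _ ⟩
  block (N ∸ m ∸ c) (i ∸ e) ++ D ∷ minimaPath m xs ∎
  where
  open ≡-Reasoning
  replicate-suc : replicate (suc i ∸ e) D ≡ replicate (i ∸ e) D ++ D ∷ []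
  replicate-suc = trans (cong (λ k → replicate k D) (trans (+-∸-assoc 1 e≤i) (+-comm 1 (i ∸ e))))
                        (replicate-+ (i ∸ e) 1 D)

decode-minimaPath : ∀ {m n} x xs → x < m → m ∸ minimum m (x ∷ xs) ≡ n → length (x ∷ xs) ≡ n →
  decode n (minimaCode m x xs) ≡ minimaPath m (x ∷ xs)
decode-minimaPath {m} x xs x<m min≡ len≡ rewrite m≥n⇒m⊓n≡n (<⇒≤ x<m) =
  trans (decode-minimaPathFrom 0 0 xs (<⇒≤ x<m) z≤n z≤n min≡ len≡) (++-assoc (replicate (m ∸ x) U) _ _)

-- Returns of a path of minima

components-ups : ∀ h k {p P Ps} → componentsFrom (h + k) p ≡ P ∷ Ps →
  componentsFrom h (replicate k U ++ p) ≡ (replicate k U ++ P) ∷ Ps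
components-ups h zero    eq rewrite +-identityʳ h = eq
components-ups h (suc k) {p} {P} {Ps} eq =
  cong (consFirst U) (components-ups (suc h) k (subst (λ i → componentsFrom i p ≡ P ∷ Ps) (+-suc h k) eq))

-- The path starts at height h, and after reading a prefix π it is at height
-- (h + m) - (minimum m π + length π).
components-minimaPath : ∀ h m x xs q →
  (∀ y π z τ → x ∷ xs ≡ (y ∷ π) ++ z ∷ τ → minimum m (y ∷ π) + length (y ∷ π) < h + m) →
  minimum m (x ∷ xs) + length (x ∷ xs) ≡ h + m →
  componentsFrom h (minimaPath m (x ∷ xs) ++ q) ≡ minimaPath m (x ∷ xs) ∷ componentsFrom 0 q
components-minimaPath h m x xs q above final
  rewrite ++-assoc (replicate (m ∸ x) U) (D ∷ minimaPath (m ⊓ x) xs) q =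
  components-ups h (m ∸ x) (down xs above final)
  where
  height : h + m ≡ h + (m ∸ x) + (m ⊓ x)
  height = trans (cong (h +_) (sym (m∸x+m⊓x≡m m x))) (sym (+-assoc h (m ∸ x) (m ⊓ x)))

  down : ∀ xs →
    (∀ y π z τ → x ∷ xs ≡ (y ∷ π) ++ z ∷ τ → minimum m (y ∷ π) + length (y ∷ π) < h + m) →
    minimum m (x ∷ xs) + length (x ∷ xs) ≡ h + m →
    componentsFrom (h + (m ∸ x)) (D ∷ minimaPath (m ⊓ x) xs ++ q) ≡ (D ∷ minimaPath (m ⊓ x) xs) ∷ componentsFrom 0 q
  -- No letter is left, so `final` forces height 1 and this D is a return.
  down [] above final
    rewrite +-cancelʳ-≡ (m ⊓ x) (h + (m ∸ x)) 1
              (trans (sym height) (trans (sym final) (+-comm (m ⊓ x) 1))) = refl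
  -- A letter remains, so `above` for the prefix `x` puts the path at height at least 2 before this
  -- D, and no cut is made.
  down (z ∷ xs) above final
    with h + (m ∸ x) | height
       | +-cancelʳ-< (m ⊓ x) 1 (h + (m ∸ x))
           (subst (1 + (m ⊓ x) <_) height (subst (_< h + m) (+-comm (m ⊓ x) 1) (above x [] z xs refl)))
  ... | suc (suc h′) | height′ | _ =
    cong (consFirst D) (components-minimaPath (suc h′) (m ⊓ x) z xs q
      (λ { y π z′ τ refl → ≤-pred (subst₂ _<_ (+-suc (minimum (m ⊓ x) (y ∷ π)) (length (y ∷ π))) height′
             (above x (y ∷ π) z′ τ refl)) })
      (suc-injective (trans (sym (+-suc (minimum (m ⊓ x) (z ∷ xs)) _)) (trans final height′))))
  ... | suc zero | _ | s≤s ()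

-- Permutations of an interval and skew sums

delete : ℕ → List ℕ → List ℕ
delete x []       = []
delete x (y ∷ ys) with x ≟ y
... | yes _ = ys
... | no  _ = y ∷ delete x ys

All-delete : ∀ {P : ℕ → Set} x {xs} → All P xs → All P (delete x xs)
All-delete x []                  = []
All-delete x {y ∷ _} (py ∷ pys) with x ≟ y
... | yes _ = pys
... | no  _ = py ∷ All-delete x pys

Unique-delete : ∀ x {xs} → Unique xs → Unique (delete x xs)
Unique-delete x []                   = []
Unique-delete x {y ∷ _} (y∉ys ∷ u) with x ≟ y
... | yes _ = u
... | no  _ = All-delete x y∉ys ∷ Unique-delete x u

∉-delete : ∀ x {xs} → Unique xs → All (x ≢_) (delete x xs)
∉-delete x []                   = []
∉-delete x {y ∷ _} (y∉ys ∷ u) with x ≟ y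
... | yes refl = y∉ys
... | no  x≢y  = x≢y ∷ ∉-delete x u

length-delete : ∀ x xs → length xs ≤ suc (length (delete x xs))
length-delete x []       = z≤n
length-delete x (y ∷ ys) with x ≟ y
... | yes _ = ≤-refl
... | no  _ = s≤s (length-delete x ys)

-- Pigeonhole, by induction on `n`: deleting the top value `b + suc n` costs at most one letter and
-- lowers the upper bound by one.
unique-bounded⇒length≤ : ∀ {b n xs} → Unique xs → All (b <_) xs → All (_≤ b + n) xs → length xs ≤ n
unique-bounded⇒length≤ {b} {zero}  {[]}     u lo hi = z≤n
unique-bounded⇒length≤ {b} {zero}  {x ∷ _}  u (b<x ∷ _) (x≤b ∷ _) =
  contradiction (<-≤-trans b<x x≤b) (subst (λ k → ¬ (b < k)) (sym (+-identityʳ b)) (<-irrefl refl))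
unique-bounded⇒length≤ {b} {suc n} {xs} u lo hi =
  ≤-trans (length-delete (b + suc n) xs)
    (s≤s (unique-bounded⇒length≤ (Unique-delete _ u) (All-delete _ lo)
      (All.zipWith below (All-delete _ hi , ∉-delete _ u))))
  where
  below : ∀ {x} → x ≤ b + suc n × b + suc n ≢ x → x ≤ b + n
  below {x} (x≤ , ≢x) = m<1+n⇒m≤n (subst (x <_) (+-suc b n) (≤∧≢⇒< x≤ (λ eq → ≢x (sym eq))))

-- xs is a permutation of {b + 1, …, b + n}; surjectivity is a consequence.
record IntervalPerm (b n : ℕ) (xs : List ℕ) : Set where
  field
    unique : Unique xs
    above  : All (b <_) xs
    below  : All (_≤ b + n) xs
    size   : length xs ≡ n

open IntervalPerm public

-- A missing value could be added to the word, giving too many distinct letters for the interval.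
IntervalPerm-∈ : ∀ {b n xs} → IntervalPerm b n xs → ∀ {v} → b < v → v ≤ b + n → v ∈ xs
IntervalPerm-∈ {b} {n} {xs} π {v} b<v v≤ with v ∈? xs
... | yes v∈xs = v∈xs
... | no  v∉xs = contradiction
  (unique-bounded⇒length≤ (¬Any⇒All¬ xs v∉xs ∷ unique π) (b<v ∷ above π) (v≤ ∷ below π))
  (subst (λ k → ¬ (suc k ≤ n)) (sym (size π)) (<-irrefl refl))

minimum-≤ : ∀ {k} m xs → k ≤ m → All (k ≤_) xs → k ≤ minimum m xs
minimum-≤ m []       k≤m []           = k≤m
minimum-≤ m (x ∷ xs) k≤m (k≤x ∷ k≤xs) = minimum-≤ (m ⊓ x) xs (⊓-glb k≤m k≤x) k≤xs

≤-minimum : ∀ m xs → minimum m xs ≤ m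
≤-minimum m []       = ≤-refl
≤-minimum m (x ∷ xs) = ≤-trans (≤-minimum (m ⊓ x) xs) (m⊓n≤m m x)

minimum-∈ : ∀ {k} m xs → k ∈ xs → minimum m xs ≤ k
minimum-∈ m (x ∷ xs) (here refl)  = ≤-trans (≤-minimum (m ⊓ x) xs) (m⊓n≤n m x)
minimum-∈ m (x ∷ xs) (there k∈xs) = minimum-∈ (m ⊓ x) xs k∈xs

-- Starting just above the interval makes this hold for the empty word as well, where the start is
-- already `suc b`.
minimum-IntervalPerm : ∀ {b n xs} → IntervalPerm b n xs → minimum (suc (b + n)) xs ≡ suc b
minimum-IntervalPerm {b} {n} {xs} π = ≤-antisym (upper n refl) (minimum-≤ _ xs (s≤s (m≤m+n b n)) (above π))
  where
  upper : ∀ k → k ≡ n → minimum (suc (b + n)) xs ≤ suc b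
  upper zero    refl = subst (minimum (suc (b + 0)) xs ≤_) (cong suc (+-identityʳ b)) (≤-minimum _ xs)
  upper (suc k) refl = minimum-∈ _ xs
    (IntervalPerm-∈ π ≤-refl (≤-trans (s≤s (m≤m+n b k)) (≤-reflexive (sym (+-suc b k)))))

Skew : List ℕ → List ℕ → Set
Skew γ δ = ∀ x y → x ∈ γ → y ∈ δ → y < x

Unique-++⁻ˡ : ∀ (xs : List ℕ) {ys} → Unique (xs ++ ys) → Unique xs
Unique-++⁻ˡ []       u         = []
Unique-++⁻ˡ (x ∷ xs) (x∉ ∷ u) = ++⁻ˡ xs x∉ ∷ Unique-++⁻ˡ xs u

Unique-++⁻ʳ : ∀ (xs : List ℕ) {ys} → Unique (xs ++ ys) → Unique ys
Unique-++⁻ʳ []       u        = u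
Unique-++⁻ʳ (x ∷ xs) (_ ∷ u) = Unique-++⁻ʳ xs u

Unique-++-≢ : ∀ (xs : List ℕ) {ys} → Unique (xs ++ ys) → ∀ {x y} → x ∈ xs → y ∈ ys → x ≢ y
Unique-++-≢ (x ∷ xs) (x∉ ∷ _) (here refl) y∈ys = All.lookup x∉ (∈-++⁺ʳ xs y∈ys)
Unique-++-≢ (x ∷ xs) (_ ∷ u)  (there x∈)  y∈ys = Unique-++-≢ xs u x∈ y∈ys

module _ {b n} (γ : List ℕ) {δ : List ℕ} (π : IntervalPerm b n (γ ++ δ)) (γ>δ : Skew γ δ) where
  private
    lengths : length γ + length δ ≡ n
    lengths = trans (sym (length-++ γ)) (size π)

    total : b + length δ + length γ ≡ b + n
    total = trans (+-assoc b (length δ) (length γ))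
                  (cong (b +_) (trans (+-comm (length δ) (length γ)) lengths))

    uniqueˡ = Unique-++⁻ˡ γ (unique π)
    uniqueʳ = Unique-++⁻ʳ γ (unique π)

    -- Otherwise `y` and the letters of `γ`, all larger than `y`, would be `suc (length γ)` distinct
    -- letters in an interval of `length γ` values. For `upper`, a small `x` overfills the interval
    -- below in the same way, together with `δ`.
    lower : ∀ {y} → y ∈ δ → y ≤ b + length δ
    lower {y} y∈δ with y ≤? b + length δ
    ... | yes y≤ = y≤
    ... | no  y≰ = contradiction
      (unique-bounded⇒length≤ {b = b + length δ} (y∉γ ∷ uniqueˡ)
        (≰⇒> y≰ ∷ All.tabulate (λ x∈γ → <-trans (≰⇒> y≰) (γ>δ _ _ x∈γ y∈δ)))
        (subst (λ k → All (_≤ k) (y ∷ γ)) (sym total)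
          (All.lookup (below π) (∈-++⁺ʳ γ y∈δ) ∷ ++⁻ˡ γ (below π))))
      (<-irrefl refl)
      where
      y∉γ : All (y ≢_) γ
      y∉γ = All.tabulate λ x∈γ → <⇒≢ (γ>δ _ _ x∈γ y∈δ)

    upper : ∀ {x} → x ∈ γ → b + length δ < x
    upper {x} x∈γ with b + length δ <? x
    ... | yes <x = <x
    ... | no  ≮x = contradiction
      (unique-bounded⇒length≤ (x∉δ ∷ uniqueʳ)
        (All.lookup (above π) (∈-++⁺ˡ x∈γ) ∷ ++⁻ʳ γ (above π))
        (≮⇒≥ ≮x ∷ All.tabulate (λ y∈δ → <⇒≤ (<-≤-trans (γ>δ _ _ x∈γ y∈δ) (≮⇒≥ ≮x)))))
      (<-irrefl refl)
      where
      x∉δ : All (x ≢_) δ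
      x∉δ = All.tabulate λ y∈δ eq → <⇒≢ (γ>δ _ _ x∈γ y∈δ) (sym eq)

  IntervalPerm-lower : IntervalPerm b (length δ) δ
  IntervalPerm-lower = record
    { unique = uniqueʳ ; above = ++⁻ʳ γ (above π) ; below = All.tabulate lower ; size = refl }

  IntervalPerm-upper : IntervalPerm (b + length δ) (length γ) γ
  IntervalPerm-upper = record
    { unique = uniqueˡ ; above = All.tabulate upper
    ; below = subst (λ k → All (_≤ k) γ) (sym total) (++⁻ˡ γ (below π)) ; size = refl }

  skew-total : b + length δ + length γ ≡ b + n
  skew-total = total

Irreducible : List ℕ → Set
Irreducible xs = ∀ y π z τ → xs ≡ (y ∷ π) ++ z ∷ τ → ¬ Skew (y ∷ π) (z ∷ τ)

-- A prefix π of length at least suc (b + n) ∸ minimum π would have to consist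
-- of all the letters from minimum π on.
irreducible⇒above : ∀ {b n xs} → IntervalPerm b n xs → Irreducible xs →
  ∀ y π z τ → xs ≡ (y ∷ π) ++ z ∷ τ →
  minimum (suc (b + n)) (y ∷ π) + length (y ∷ π) < suc (b + n)
irreducible⇒above {b} {n} perm irr y π z τ refl
  with minimum (suc (b + n)) (y ∷ π) + length (y ∷ π) <? suc (b + n)
... | yes lt = lt
... | no  ≮  = contradiction skew (irr y π z τ refl)
  where
  M = suc (b + n)
  γ = y ∷ π
  m = minimum M γ

  m≤∈ : ∀ {x} → x ∈ γ → m ≤ x
  m≤∈ = minimum-∈ M γ

  b<m : b < m
  b<m = minimum-≤ M γ (s≤s (m≤m+n b n)) (++⁻ˡ γ (above perm))

  skew : Skew γ (z ∷ τ)
  skew x w x∈γ w∈δ with w <? m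
  ... | yes w<m = <-≤-trans w<m (m≤∈ x∈γ)
  -- Such a `w` would join `γ` in the interval from `m` to `b + n`, which has at most `length γ`
  -- values. The bound `m ∸ 1` appears because lower bounds of intervals are strict.
  ... | no  w≮m = contradiction (unique-bounded⇒length≤ {b = m ∸ 1} {n = b + n ∸ (m ∸ 1)} {xs = w ∷ γ}
        (All.tabulate (λ x∈ eq → Unique-++-≢ γ (unique perm) x∈ w∈δ (sym eq)) ∷ Unique-++⁻ˡ γ (unique perm))
        (pred< (≮⇒≥ w≮m) ∷ All.tabulate (λ x∈ → pred< (m≤∈ x∈)))
        (bound (All.lookup (below perm) (∈-++⁺ʳ γ w∈δ)) ∷ All.map bound (++⁻ˡ γ (below perm))))
        (<⇒≱ (s≤s short))
    where
    1+pred : suc (m ∸ 1) ≡ m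
    1+pred = m+[n∸m]≡n (≤-trans (s≤s z≤n) b<m)

    pred< : ∀ {v} → m ≤ v → m ∸ 1 < v
    pred< = subst (_≤ _) (sym 1+pred)

    bound : ∀ {v} → v ≤ b + n → v ≤ m ∸ 1 + (b + n ∸ (m ∸ 1))
    bound v≤ = ≤-trans v≤ (m≤n+m∸n (b + n) (m ∸ 1))

    short : b + n ∸ (m ∸ 1) ≤ length γ
    short = m≤n+o⇒m∸n≤o (b + n) (m ∸ 1)
      (≤-pred (subst (λ k → M ≤ k + length γ) (sym 1+pred) (≮⇒≥ ≮)))

-- Reading the minima of a word off its code

-- The current minimum `m` is treated as the first letter. A letter below `v` further on is what
-- makes `v` a minimum other than the last.
formerMinima⁺ : ∀ {m xs} ys {v zs} → m ∷ xs ≡ ys ++ v ∷ zs → All (v <_) ys → Any (_< v) zs →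
  v ∈ formerMinima m xs
formerMinima⁺ {m} {x ∷ xs} [] refl [] any with x <? m
... | yes _ = here refl
formerMinima⁺ {m} {x ∷ xs} [] refl [] (here x<m)  | no x≮m = contradiction x<m x≮m
formerMinima⁺ {m} {x ∷ xs} [] refl [] (there any) | no _   = formerMinima⁺ [] refl [] any
formerMinima⁺ {m} {x ∷ xs} (_ ∷ []) refl (x<m ∷ []) any with x <? m
... | yes _   = there (formerMinima⁺ [] refl [] any)
... | no  x≮m = contradiction x<m x≮m
-- Of the two leading letters `m` and `x`, the one that remains the current minimum is kept in front
-- and the other is dropped.
formerMinima⁺ {m} {x ∷ xs} (_ ∷ _ ∷ ys) eq (v<m ∷ v<x ∷ v<ys) any
  with x <? m | ∷-injectiveˡ eq | ∷-injective (∷-injectiveʳ eq)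
... | yes _ | refl | refl , eq′ = there (formerMinima⁺ (x ∷ ys) (cong (x ∷_) eq′) (v<x ∷ v<ys) any)
... | no  _ | refl | refl , eq′ = formerMinima⁺ (m ∷ ys) (cong (m ∷_) eq′) (v<m ∷ v<ys) any

formerMinima⁻ : ∀ {m xs v} → v ∈ formerMinima m xs →
  ∃₂ λ ys zs → m ∷ xs ≡ ys ++ v ∷ zs × All (v <_) ys × Any (_< v) zs
formerMinima⁻ {m} {x ∷ xs} v∈ with x <? m
formerMinima⁻ {m} {x ∷ xs} (here refl) | yes x<m = [] , x ∷ xs , refl , [] , here x<m
formerMinima⁻ {m} {x ∷ xs} (there v∈) | yes x<m with formerMinima⁻ {x} {xs} v∈
... | []     , zs , refl , []         , any = m ∷ [] , zs , refl , x<m ∷ [] , any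
... | _ ∷ ys , zs , refl , v<x ∷ v<ys , any = m ∷ x ∷ ys , zs , refl , <-trans v<x x<m ∷ v<x ∷ v<ys , any
formerMinima⁻ {m} {x ∷ xs} v∈ | no x≮m with formerMinima⁻ {m} {xs} v∈
... | []     , zs , refl , []         , any = [] , x ∷ zs , refl , [] , there any
... | _ ∷ ys , zs , refl , v<m ∷ v<ys , any =
  m ∷ x ∷ ys , zs , refl , v<m ∷ <-≤-trans v<m (≮⇒≥ x≮m) ∷ v<ys , any

minimaPositionsFrom⁺ : ∀ {m i xs} ys {z zs} → xs ≡ ys ++ z ∷ zs → All (z <_) (m ∷ ys) →
  i + length ys ∈ minimaPositions m i xs
minimaPositionsFrom⁺ {m} {i} {x ∷ xs} [] refl (x<m ∷ []) with x <? m
... | yes _   = here (+-identityʳ i)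
... | no  x≮m = contradiction x<m x≮m
minimaPositionsFrom⁺ {m} {i} {x ∷ xs} (_ ∷ ys) refl (z<m ∷ z<x ∷ z<ys) with x <? m
... | yes _ = there (subst (_∈ minimaPositions x (suc i) xs) (sym (+-suc i (length ys)))
    (minimaPositionsFrom⁺ ys refl (z<x ∷ z<ys)))
... | no  _ = subst (_∈ minimaPositions m (suc i) xs) (sym (+-suc i (length ys)))
    (minimaPositionsFrom⁺ ys refl (z<m ∷ z<ys))

minimaPositionsFrom⁻ : ∀ {m i xs p} → p ∈ minimaPositions m i xs →
  ∃₂ λ ys z → ∃ λ zs → xs ≡ ys ++ z ∷ zs × All (z <_) (m ∷ ys) × p ≡ i + length ys
minimaPositionsFrom⁻ {m} {i} {x ∷ xs} p∈ with x <? m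
minimaPositionsFrom⁻ {m} {i} {x ∷ xs} (here refl) | yes x<m =
  [] , x , xs , refl , x<m ∷ [] , sym (+-identityʳ i)
minimaPositionsFrom⁻ {m} {i} {x ∷ xs} (there p∈) | yes x<m
  with ys , z , zs , refl , z<x ∷ z<ys , refl ← minimaPositionsFrom⁻ {x} {suc i} {xs} p∈ =
  x ∷ ys , z , zs , refl , <-trans z<x x<m ∷ z<x ∷ z<ys , sym (+-suc i (length ys))
minimaPositionsFrom⁻ {m} {i} {x ∷ xs} p∈ | no x≮m
  with ys , z , zs , refl , z<m ∷ z<ys , refl ← minimaPositionsFrom⁻ {m} {suc i} {xs} p∈ =
  x ∷ ys , z , zs , refl , z<m ∷ <-≤-trans z<m (≮⇒≥ x≮m) ∷ z<ys , sym (+-suc i (length ys))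

-- The bound on `length ys` excludes the first letter, a minimum at position 0 that has no entry in
-- the code.
minimaPositions⁺ : ∀ {x xs} ys {z zs} → x ∷ xs ≡ ys ++ z ∷ zs → All (z <_) ys → 1 ≤ length ys →
  length ys ∈ minimaPositions x 1 xs
minimaPositions⁺ (_ ∷ ys) refl z<ys _ = minimaPositionsFrom⁺ ys refl z<ys

minimaPositions⁻ : ∀ {x xs p} → p ∈ minimaPositions x 1 xs →
  ∃₂ λ ys z → ∃ λ zs → x ∷ xs ≡ ys ++ z ∷ zs × All (z <_) ys × p ≡ length ys × 1 ≤ p
minimaPositions⁻ {x} {xs} p∈ with ys , z , zs , refl , z<ys , refl ← minimaPositionsFrom⁻ {x} {1} {xs} p∈ =
  x ∷ ys , z , zs , refl , z<ys , refl , s≤s z≤n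

formerMinima-≤ : ∀ m xs → All (_≤ m) (formerMinima m xs)
formerMinima-≤ m []       = []
formerMinima-≤ m (x ∷ xs) with x <? m
... | yes x<m = ≤-refl ∷ All.map (λ v≤x → ≤-trans v≤x (<⇒≤ x<m)) (formerMinima-≤ x xs)
... | no  _   = formerMinima-≤ m xs

formerMinima-sorted : ∀ {N m} xs → m ≤ N → AllPairs _<_ (map (N ∸_) (formerMinima m xs))
formerMinima-sorted xs m≤N = AllPairs.map⁺ (go xs m≤N)
  where
  go : ∀ {N m} xs → m ≤ N → AllPairs (λ u v → N ∸ u < N ∸ v) (formerMinima m xs)
  go []       m≤N = []
  go {N} {m} (x ∷ xs) m≤N with x <? m
  ... | yes x<m = All.map (λ v≤x → ∸-monoʳ-< (≤-<-trans v≤x x<m) m≤N) (formerMinima-≤ x xs)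
                  ∷ go xs (≤-trans (<⇒≤ x<m) m≤N)
  ... | no  _   = go xs m≤N

minimaPositions-≥ : ∀ m i xs → All (i ≤_) (minimaPositions m i xs)
minimaPositions-≥ m i []       = []
minimaPositions-≥ m i (x ∷ xs) with x <? m
... | yes _ = ≤-refl ∷ All.map <⇒≤ (minimaPositions-≥ x (suc i) xs)
... | no  _ = All.map <⇒≤ (minimaPositions-≥ m (suc i) xs)

minimaPositions-sorted : ∀ m i xs → AllPairs _<_ (minimaPositions m i xs)
minimaPositions-sorted m i []       = []
minimaPositions-sorted m i (x ∷ xs) with x <? m
... | yes _ = minimaPositions-≥ x (suc i) xs ∷ minimaPositions-sorted x (suc i) xs
... | no  _ = minimaPositions-sorted m (suc i) xs

∈-complement⁺ : ∀ {n xs a} → 1 ≤ a → a ≤ n ∸ 2 → a ∉ xs → a ∈ complement n xs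
∈-complement⁺ {n} {xs} (s≤s z≤n) a≤ a∉ = ∈-filter⁺ (_∉? xs) (∈-applyDownFrom⁺ suc a≤) a∉

∈-complement⁻ : ∀ {n xs a} → a ∈ complement n xs → 1 ≤ a × a ≤ n ∸ 2 × a ∉ xs
∈-complement⁻ {n} {xs} a∈ with a∈′ , a∉ ← ∈-filter⁻ (_∉? xs) {xs = applyDownFrom suc (n ∸ 2)} a∈
  with i , i< , refl ← ∈-applyDownFrom⁻ suc a∈′ = s≤s z≤n , i< , a∉

complement-sorted : ∀ {k n} xs → n ∸ 2 ≤ k → AllPairs _<_ (map (k ∸_) (complement n xs))
complement-sorted {k} {n} xs n-2≤k = AllPairs.map⁺ (AllPairs.filter⁺ (_∉? xs)
  (AllPairs.applyDownFrom⁺₁ suc (n ∸ 2) λ j<i i< → ∸-monoʳ-< (s≤s j<i) (≤-trans i< n-2≤k)))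

head-≤ : ∀ {x e xs} → All (x <_) xs → e ∈ x ∷ xs → x ≤ e
head-≤ x< (here refl) = ≤-refl
head-≤ x< (there e∈)  = <⇒≤ (All.lookup x< e∈)

-- Reduces equality of codes to equality of sets, the form in which complements can be compared.
sorted-ext : ∀ {xs ys} → AllPairs _<_ xs → AllPairs _<_ ys →
  (∀ {e} → e ∈ xs → e ∈ ys) → (∀ {e} → e ∈ ys → e ∈ xs) → xs ≡ ys
sorted-ext {[]}    {[]}    _ _ _ _ = refl
sorted-ext {[]}    {_ ∷ _} _ _ _ g with () ← g (here refl)
sorted-ext {_ ∷ _} {[]}    _ _ f _ with () ← f (here refl)
sorted-ext {x ∷ xs} {y ∷ ys} (x< ∷ sx) (y< ∷ sy) f g
  with refl ← ≤-antisym (head-≤ x< (g (here refl))) (head-≤ y< (f (here refl))) =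
  cong (x ∷_) (sorted-ext sx sy (λ e∈ → strip (All.lookup x< e∈) (f (there e∈)))
                                (λ e∈ → strip (All.lookup y< e∈) (g (there e∈))))
  where
  strip : ∀ {x e xs} → x < e → e ∈ x ∷ xs → e ∈ xs
  strip x<e (here refl) = contradiction x<e (<-irrefl refl)
  strip x<e (there e∈)  = e∈

-- Reverse complement

reverseComplement : ℕ → List ℕ → List ℕ
reverseComplement K []       = []
reverseComplement K (x ∷ xs) = reverseComplement K xs ++ [ K ∸ x ]

module _ (K : ℕ) where
  private
    rc = reverseComplement K

  rc-++ : ∀ xs ys → rc (xs ++ ys) ≡ rc ys ++ rc xs
  rc-++ [] ys = sym (++-identityʳ (rc ys))
  rc-++ (x ∷ xs) ys = trans (cong (_++ [ K ∸ x ]) (rc-++ xs ys)) (++-assoc (rc ys) (rc xs) _)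

  rc-split : ∀ ys z zs → rc (ys ++ z ∷ zs) ≡ rc zs ++ (K ∸ z) ∷ rc ys
  rc-split ys z zs = trans (rc-++ ys (z ∷ zs)) (++-assoc (rc zs) _ _)

  rc-involutive : ∀ {xs} → All (_≤ K) xs → rc (rc xs) ≡ xs
  rc-involutive []                   = refl
  rc-involutive {x ∷ xs} (x≤K ∷ xs≤K) =
    trans (rc-++ (rc xs) _) (cong₂ _∷_ (m∸[m∸n]≡n x≤K) (rc-involutive xs≤K))

  length-rc : ∀ xs → length (rc xs) ≡ length xs
  length-rc []       = refl
  length-rc (x ∷ xs) = trans (length-++ (rc xs)) (trans (+-comm _ 1) (cong suc (length-rc xs)))

  All-rc : ∀ {P Q : ℕ → Set} {xs} → (∀ {x} → P x → Q (K ∸ x)) → All P xs → All Q (rc xs)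
  All-rc f []         = []
  All-rc f (px ∷ pxs) = ++⁺ (All-rc f pxs) (f px ∷ [])

  ∈-rc : ∀ {x xs} → x ∈ xs → K ∸ x ∈ rc xs
  ∈-rc {xs = _ ∷ xs} (here refl) = ∈-++⁺ʳ (rc xs) (here refl)
  ∈-rc (there x∈)  = ∈-++⁺ˡ (∈-rc x∈)

  Unique-rc : ∀ {xs} → All (_≤ K) xs → Unique xs → Unique (rc xs)
  Unique-rc []           []       = []
  Unique-rc {x ∷ xs} (x≤K ∷ xs≤K) (x∉ ∷ u) = AllPairs.++⁺ (Unique-rc xs≤K u) ([] ∷ [])
    (All-rc (λ (y≤K , x≢y) → (λ eq → x≢y (sym (∸-cancelˡ-≡ y≤K x≤K eq))) ∷ [])
      (All.zip (xs≤K , x∉)))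

  IntervalPerm-rc : ∀ {b n xs} → b + n < K → IntervalPerm b n xs →
    IntervalPerm (K ∸ suc (b + n)) n (rc xs)
  IntervalPerm-rc {b} {n} {xs} <K π = record
    { unique = Unique-rc (All.map (λ x≤ → ≤-trans x≤ (<⇒≤ <K)) (below π)) (unique π)
    ; above  = All-rc (λ x≤ → ∸-monoʳ-< (s≤s x≤) <K) (below π)
    ; below  = All-rc (λ {x} b<x → ≤-trans (∸-monoʳ-≤ K b<x) (≤-reflexive total)) (above π)
    ; size   = trans (length-rc xs) (size π)
    }
    where
    total : K ∸ suc b ≡ K ∸ suc (b + n) + n
    total = trans (sym (m∸n+n≡m n≤)) (cong (_+ n) (∸-+-assoc K (suc b) n))
      where
      n≤ : n ≤ K ∸ suc b
      n≤ = ≤-trans (≤-reflexive (sym (m+n∸m≡n (suc b) n))) (∸-monoˡ-≤ (suc b) <K)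

-- Minima and maxima of an indecomposable word avoiding 123

Avoids : List ℕ → Set
Avoids xs = ∀ ys z zs → xs ≡ ys ++ z ∷ zs → ∀ {x y} → x ∈ ys → y ∈ zs → x < z → ¬ z < y

unique-split : ∀ (ys : List ℕ) {v zs} ys′ {zs′} → Unique (ys ++ v ∷ zs) → ys ++ v ∷ zs ≡ ys′ ++ v ∷ zs′ → ys ≡ ys′
unique-split []       []         u eq = refl
unique-split []       (_ ∷ ys′)  (x∉ ∷ _) refl = contradiction refl (All.lookup x∉ (∈-++⁺ʳ ys′ (here refl)))
unique-split (_ ∷ ys) []         (x∉ ∷ _) refl = contradiction refl (All.lookup x∉ (∈-++⁺ʳ ys (here refl)))
unique-split (y ∷ ys) (y′ ∷ ys′) (_ ∷ u)  eq with refl , eq′ ← ∷-injective eq =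
  cong (y ∷_) (unique-split ys ys′ u eq′)

length-split : ∀ (ys : List A) {v zs} ys′ {v′ zs′} → ys ++ v ∷ zs ≡ ys′ ++ v′ ∷ zs′ →
  length ys ≡ length ys′ → ys ≡ ys′ × v ≡ v′
length-split []       []         eq _ = refl , ∷-injectiveˡ eq
length-split (y ∷ ys) (y′ ∷ ys′) eq l with refl , eq′ ← ∷-injective eq
  with refl , v≡ ← length-split ys ys′ eq′ (suc-injective l) = refl , v≡

-- A smaller letter before `z` and a larger one after it would form an increasing triple with it.
dichotomy : ∀ {xs} → Unique xs → Avoids xs → ∀ ys z zs → xs ≡ ys ++ z ∷ zs →
  All (z <_) ys ⊎ All (_< z) zs
dichotomy u avoids ys z zs refl with All.all? (z <?_) ys | All.all? (_<? z) zs
... | yes z<ys | _        = inj₁ z<ys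
... | no  _    | yes zs<z = inj₂ zs<z
... | no  ¬ys  | no  ¬zs
  with x , x∈ , z≮x ← find (¬All⇒Any¬ (z <?_) ys ¬ys)
     | y , y∈ , y≮z ← find (¬All⇒Any¬ (_<? z) zs ¬zs) =
  contradiction
    (≤∧≢⇒< (≮⇒≥ y≮z) (All.lookup (AllPairs.head (Unique-++⁻ʳ ys u)) y∈))
    (avoids ys z zs refl x∈ y∈ (≤∧≢⇒< (≮⇒≥ z≮x) (Unique-++-≢ ys u x∈ (here refl))))

-- All letters before `z` are above it and all letters after it are below it, so if any other letter
-- exists, a cut next to `z` exhibits a skew sum.
exclusive : ∀ {xs} → Irreducible xs → ∀ ys z zs → xs ≡ ys ++ z ∷ zs →
  All (z <_) ys → All (_< z) zs → ys ≡ [] × zs ≡ []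
exclusive irr []       z []       refl z<ys zs<z = refl , refl
exclusive irr (y ∷ ys) z []       refl z<ys zs<z =
  contradiction (λ { _ _ x∈ (here refl) → All.lookup z<ys x∈ }) (irr y ys z [] refl)
exclusive irr []       z (w ∷ zs) refl z<ys zs<z =
  contradiction (λ { _ _ (here refl) y∈ → All.lookup zs<z y∈ }) (irr z [] w zs refl)
exclusive irr (y ∷ ys) z (w ∷ zs) refl z<ys zs<z =
  contradiction skew (irr y (ys ++ [ z ]) w zs (cong (y ∷_) (sym (++-assoc ys [ z ] (w ∷ zs)))))
  where
  skew : Skew (y ∷ ys ++ [ z ]) (w ∷ zs)
  skew u v u∈ v∈ with ∈-++⁻ (y ∷ ys) u∈
  ... | inj₁ u∈ys        = <-trans (All.lookup zs<z v∈) (All.lookup z<ys u∈ys)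
  ... | inj₂ (here refl) = All.lookup zs<z v∈

split-at : ∀ d (xs : List A) → d < length xs → ∃₂ λ ys z → ∃ λ zs → xs ≡ ys ++ z ∷ zs × length ys ≡ d
split-at zero    (x ∷ xs) _          = [] , x , xs , refl , refl
split-at (suc d) (x ∷ xs) (s≤s d<) with ys , z , zs , refl , refl ← split-at d xs d< =
  x ∷ ys , z , zs , refl , refl

2+≤ : ∀ {n d} → 1 ≤ d → d ≤ n ∸ 2 → 2 + d ≤ n
2+≤ {zero}        1≤d d≤ = contradiction (≤-trans 1≤d d≤) λ ()
2+≤ {suc zero}    1≤d d≤ = contradiction (≤-trans 1≤d d≤) λ ()
2+≤ {suc (suc n)} 1≤d d≤ = s≤s (s≤s d≤)

∸-swap : ∀ m n o → m ∸ n ∸ o ≡ m ∸ o ∸ n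
∸-swap m n o = trans (∸-+-assoc m n o) (trans (cong (m ∸_) (+-comm n o)) (sym (∸-+-assoc m o n)))

-- For an indecomposable word the code of the reverse complement y ∷ ys of x ∷ xs
-- is the complementary code.
module _ {b n x xs y ys} (K : ℕ)
  (perm : IntervalPerm b n (x ∷ xs)) (b+n<K : b + n < K)
  (avoids : Avoids (x ∷ xs)) (irr : Irreducible (x ∷ xs))
  (rc≡ : reverseComplement K (x ∷ xs) ≡ y ∷ ys)
  where

  private
    rc = reverseComplement K

    xs≤K : All (_≤ K) (x ∷ xs)
    xs≤K = All.map (λ v≤ → ≤-trans v≤ (<⇒≤ b+n<K)) (below perm)

    rc≤K : All (_≤ K) (y ∷ ys)
    rc≤K = subst (All (_≤ K)) rc≡ (All-rc K {P = λ _ → ⊤} (λ {v} _ → m∸n≤m K v) (All.universal _ (x ∷ xs)))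

    rc-cosplit : ∀ ps {u} qs → y ∷ ys ≡ ps ++ u ∷ qs → x ∷ xs ≡ rc qs ++ (K ∸ u) ∷ rc ps
    rc-cosplit ps {u} qs eq =
      trans (sym (rc-involutive K xs≤K)) (trans (cong rc (trans rc≡ eq)) (rc-split K ps u qs))

    <-rc : ∀ {u ps} → All (u <_) ps → All (_≤ K) ps → All (_< K ∸ u) (rc ps)
    <-rc u<ps ps≤K = All-rc K (λ (u<w , w≤K) → ∸-monoʳ-< u<w w≤K) (All.zip (u<ps , ps≤K))

    rc-< : ∀ {v zs} → All (_< v) zs → v ≤ K → All (K ∸ v <_) (rc zs)
    rc-< zs<v v≤K = All-rc K (λ w<v → ∸-monoʳ-< w<v v≤K) zs<v

    <b+n : ∀ {v w} → v < w → w ∈ x ∷ xs → v < b + n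
    <b+n v<w w∈ = <-≤-trans v<w (All.lookup (below perm) w∈)

    gap-∸ : ∀ {v} → b ≤ v → b + n ∸ v ≡ n ∸ (v ∸ b)
    gap-∸ {v} b≤v = trans (cong (b + n ∸_) (sym (m+[n∸m]≡n b≤v))) ([m+n]∸[m+o]≡n∸o b n (v ∸ b))

    gap : ∀ {v} → b ≤ v → v ≤ b + n → n ∸ (b + n ∸ v) ≡ v ∸ b
    gap {v} b≤v v≤ = trans (cong (n ∸_) (gap-∸ b≤v))
      (m∸[m∸n]≡n (≤-trans (∸-monoˡ-≤ b v≤) (≤-reflexive (m+n∸m≡n b n))))

    values positions : List ℕ
    values    = map (n ∸_) (complement n (map (_∸ 1) (map (suc (b + n) ∸_) (formerMinima x xs))))
    positions = map (n ∸ 1 ∸_) (complement n (minimaPositions x 1 xs))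

    shift : ∀ u → suc (b + n) ∸ u ∸ 1 ≡ b + n ∸ u
    shift u = ∸-swap (suc (b + n)) u 1

  -- The reflected letter `v = K ∸ u` is a right-to-left maximum with a larger letter `K ∸ w` before
  -- it. Hence `v < b + n`, and by `exclusive` it is not a left-to-right minimum; in particular it
  -- is not `suc b`. So the number `b + n ∸ v` lies between 1 and `n ∸ 2` and is not taken by a
  -- minimum.
  values⇒ : ∀ {u} → u ∈ formerMinima y ys →
    K ∸ b ∸ u ∈ values
  values⇒ {u} u∈ with ps , qs , eq , u<ps , any ← formerMinima⁻ {y} {ys} u∈
    with w , w∈ , w<u ← find any =
    subst (_∈ values) (trans (gap b≤v (<⇒≤ v<b+n)) (∸-swap K u b))
      (∈-map⁺ (n ∸_) (∈-complement⁺ {n} (m<n⇒0<n∸m v<b+n)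
        (≤-trans (∸-monoʳ-≤ (b + n) 2+b≤v) (≤-reflexive ([m+n]∸[m+o]≡n∸o b n 2))) notFormer))
    where
    v = K ∸ u

    split : x ∷ xs ≡ rc qs ++ v ∷ rc ps
    split = rc-cosplit ps qs eq

    ∈ˡ : ∀ {w} → w ∈ rc qs → w ∈ x ∷ xs
    ∈ˡ w∈ = subst (_ ∈_) (sym split) (∈-++⁺ˡ w∈)

    v∈ : v ∈ x ∷ xs
    v∈ = subst (v ∈_) (sym split) (∈-++⁺ʳ (rc qs) (here refl))

    b≤v : b ≤ v
    b≤v = <⇒≤ (All.lookup (above perm) v∈)

    psu≤K : All (_≤ K) (ps ++ u ∷ qs)
    psu≤K = subst (All (_≤ K)) eq rc≤K

    u≤K : u ≤ K
    u≤K = All.head (++⁻ʳ ps psu≤K)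

    zs<v : All (_< v) (rc ps)
    zs<v = <-rc u<ps (++⁻ˡ ps psu≤K)

    v<b+n : v < b + n
    v<b+n = <b+n (∸-monoʳ-< w<u u≤K) (∈ˡ (∈-rc K w∈))

    ¬min : ¬ All (v <_) (rc qs)
    ¬min v<rcqs with exclusive irr (rc qs) v (rc ps) split v<rcqs zs<v
    ... | rcqs≡[] , _ with () ← subst (K ∸ w ∈_) rcqs≡[] (∈-rc K w∈)

    u-split : AllPairs _≢_ (rc qs ++ v ∷ rc ps)
    u-split = subst (AllPairs _≢_) split (unique perm)

    2+b≤v : b + 2 ≤ v
    2+b≤v with b + 2 ≤? v
    ... | yes ≤v = ≤v
    ... | no  ≰v = contradiction (All.tabulate λ {w} w∈ → ≤∧≢⇒<
          (≤-trans (m<1+n⇒m≤n (subst (v <_) (+-comm b 2) (≰⇒> ≰v))) (All.lookup (above perm) (∈ˡ w∈)))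
          (λ eq → Unique-++-≢ (rc qs) u-split w∈ (here refl) (sym eq))) ¬min

    notFormer : b + n ∸ v ∉ map (_∸ 1) (map (suc (b + n) ∸_) (formerMinima x xs))
    notFormer a∈ with _ , c∈ , a≡ ← ∈-map⁻ (_∸ 1) a∈ with u′ , u′∈ , refl ← ∈-map⁻ (suc (b + n) ∸_) c∈
      with ys′ , zs′ , eq′ , u′<ys , _ ← formerMinima⁻ {x} {xs} u′∈
      with refl ← ∸-cancelˡ-≡ (<⇒≤ v<b+n)
             (All.lookup (below perm) (subst (u′ ∈_) (sym eq′) (∈-++⁺ʳ ys′ (here refl))))
             (trans a≡ (shift u′)) =
      ¬min (subst (All (v <_)) (unique-split ys′ (rc qs) (subst (AllPairs _≢_) eq′ (unique perm))
              (trans (sym eq′) split)) u′<ys)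

  -- The number `a` belongs to the letter `v = b + n ∸ a`, strictly between `suc b` and `b + n`. If
  -- `v` were a minimum, `suc b` would come after it and `a` would be in the code. So `v` is a
  -- maximum, and `b + n` comes before it; reflected, that is the smaller letter after `K ∸ v`.
  values⇐ : ∀ {e} → e ∈ values → e ∈ map (K ∸ b ∸_) (formerMinima y ys)
  values⇐ e∈ with a , a∈ , refl ← ∈-map⁻ (n ∸_) e∈
    with 1≤a , a≤ , a∉ ← ∈-complement⁻ {n} {map (_∸ 1) (map (suc (b + n) ∸_) (formerMinima x xs))} a∈ =
    subst (_∈ map (K ∸ b ∸_) (formerMinima y ys)) back (∈-map⁺ (K ∸ b ∸_) maximum)
    where
    v = b + n ∸ a

    a≤n : a ≤ n
    a≤n = ≤-trans a≤ (m∸n≤m n 2)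

    2≤n : 2 ≤ n
    2≤n = ≤-trans (m≤m+n 2 a) (2+≤ {n} 1≤a a≤)

    v≡ : v ≡ b + (n ∸ a)
    v≡ = +-∸-assoc b a≤n

    v<b+n : v < b + n
    v<b+n = subst (_< b + n) (sym v≡) (+-monoʳ-< b (∸-monoʳ-< 1≤a a≤n))

    1+b<v : suc b < v
    1+b<v = subst (suc b <_) (sym v≡) (subst (_≤ b + (n ∸ a)) (+-comm b 2)
      (+-monoʳ-≤ b (≤-trans (≤-reflexive (sym (m∸[m∸n]≡n 2≤n))) (∸-monoʳ-≤ n a≤))))

    b≤v : b ≤ v
    b≤v = ≤-trans (n≤1+n b) (<⇒≤ 1+b<v)

    v≤K : v ≤ K
    v≤K = <⇒≤ (<-trans v<b+n b+n<K)

    maximum : K ∸ v ∈ formerMinima y ys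
    maximum with ls , rs , eq ← ∈-∃++ (IntervalPerm-∈ perm (<-trans ≤-refl 1+b<v) (<⇒≤ v<b+n))
      with dichotomy (unique perm) avoids ls v rs eq
    ... | inj₁ v<ls = contradiction (subst (_∈ _) former≡ (∈-map⁺ (_∸ 1) (∈-map⁺ (suc (b + n) ∸_)
            (formerMinima⁺ ls eq v<ls (least (∈-++⁻ ls (subst (suc b ∈_) eq bottom∈))))))) a∉
      where
      bottom∈ : suc b ∈ x ∷ xs
      bottom∈ = IntervalPerm-∈ perm ≤-refl (<⇒≤ (<-trans 1+b<v v<b+n))
      former≡ : suc (b + n) ∸ v ∸ 1 ≡ a
      former≡ = trans (shift v) (m∸[m∸n]≡n (≤-trans a≤n (m≤n+m n b)))
      least : suc b ∈ ls ⊎ suc b ∈ v ∷ rs → Any (_< v) rs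
      least (inj₁ ∈ls)          = contradiction (All.lookup v<ls ∈ls) (<-asym 1+b<v)
      least (inj₂ (here eq))    = contradiction 1+b<v (<-irrefl eq)
      least (inj₂ (there ∈rs))  = lose ∈rs 1+b<v
    ... | inj₂ rs<v = formerMinima⁺ (rc rs)
            (trans (sym rc≡) (trans (cong rc eq) (rc-split K ls v rs))) (rc-< rs<v v≤K)
            (greatest (∈-++⁻ ls (subst (b + n ∈_) eq top∈)))
      where
      top∈ : b + n ∈ x ∷ xs
      top∈ = IntervalPerm-∈ perm (≤-<-trans b≤v v<b+n) ≤-refl
      greatest : b + n ∈ ls ⊎ b + n ∈ v ∷ rs → Any (_< K ∸ v) (rc ls)
      greatest (inj₁ ∈ls)         = lose (∈-rc K ∈ls) (∸-monoʳ-< v<b+n (<⇒≤ b+n<K))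
      greatest (inj₂ (here eq))   = contradiction v<b+n (<-irrefl (sym eq))
      greatest (inj₂ (there ∈rs)) = contradiction (All.lookup rs<v ∈rs) (<-asym v<b+n)

    back : K ∸ b ∸ (K ∸ v) ≡ n ∸ a
    back = trans (∸-swap K b (K ∸ v)) (trans (cong (_∸ b) (m∸[m∸n]≡n v≤K))
             (trans (cong (_∸ b) v≡) (m+n∸m≡n b (n ∸ a))))

  -- Reflection exchanges the letters before and after, whose numbers add up to `n ∸ 1`. Both
  -- numbers are positive: `length ps` because the code skips position 0, the other because a first
  -- letter would be a minimum as well as a maximum.
  positions⇒ : ∀ {e} → e ∈ minimaPositions y 1 ys → e ∈ positions
  positions⇒ e∈ with ps , u , qs , eq , u<ps , refl , 1≤e ← minimaPositions⁻ {y} {ys} e∈ =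
    subst (_∈ positions) (trans (cong (_∸ length (rc qs)) n-1≡) (m+n∸m≡n (length (rc qs)) (length ps)))
      (∈-map⁺ (n ∸ 1 ∸_) (∈-complement⁺ {n} 1≤d d≤ notPosition))
    where
    split : x ∷ xs ≡ rc qs ++ (K ∸ u) ∷ rc ps
    split = rc-cosplit ps qs eq

    zs<v : All (_< K ∸ u) (rc ps)
    zs<v = <-rc u<ps (++⁻ˡ ps (subst (All (_≤ K)) eq rc≤K))

    ¬min : ¬ All (K ∸ u <_) (rc qs)
    ¬min v<rcqs with exclusive irr (rc qs) (K ∸ u) (rc ps) split v<rcqs zs<v
    ... | _ , rcps≡[] with () ← subst (1 ≤_) (trans (sym (length-rc K ps)) (cong length rcps≡[])) 1≤e

    n≡ : n ≡ suc (length (rc qs) + length ps)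
    n≡ = trans (sym (size perm)) (trans (cong length split) (trans (length-++ (rc qs))
           (trans (+-suc _ _) (cong (λ l → suc (length (rc qs) + l)) (length-rc K ps)))))

    n-1≡ : n ∸ 1 ≡ length (rc qs) + length ps
    n-1≡ = cong (_∸ 1) n≡

    1≤d : 1 ≤ length (rc qs)
    1≤d with rc qs | ¬min
    ... | []    | ¬min = contradiction [] ¬min
    ... | _ ∷ _ | _    = s≤s z≤n

    d≤ : length (rc qs) ≤ n ∸ 2
    d≤ = ≤-trans (m+n≤o⇒m≤o∸n (length (rc qs)) (≤-trans (+-monoʳ-≤ (length (rc qs)) 1≤e) (≤-reflexive (sym n-1≡))))
                 (≤-reflexive (∸-+-assoc n 1 1))

    notPosition : length (rc qs) ∉ minimaPositions x 1 xs
    notPosition d∈ with ys′ , z′ , zs′ , eq′ , z′<ys , d≡ , _ ← minimaPositions⁻ {x} {xs} d∈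
      with refl , refl ← length-split (rc qs) ys′ (trans (sym split) eq′) d≡ = ¬min z′<ys

  positions⇐ : ∀ {e} → e ∈ positions → e ∈ minimaPositions y 1 ys
  positions⇐ e∈ with d , d∈ , refl ← ∈-map⁻ (n ∸ 1 ∸_) e∈
    with 1≤d , d≤ , d∉ ← ∈-complement⁻ {n} {minimaPositions x 1 xs} d∈
    with ls , z , rs , eq , refl ← split-at d (x ∷ xs) (subst (d <_) (sym (size perm)) (<⇒≤ (2+≤ {n} 1≤d d≤)))
    with dichotomy (unique perm) avoids ls z rs eq
  ... | inj₁ z<ls = contradiction (minimaPositions⁺ ls eq z<ls 1≤d) d∉
  ... | inj₂ rs<z = subst (_∈ minimaPositions y 1 ys) (trans (length-rc K rs) (sym n-1-d≡))
          (minimaPositions⁺ (rc rs) (trans (sym rc≡) (trans (cong rc eq) (rc-split K ls z rs)))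
            (rc-< rs<z (All.head (++⁻ʳ ls (subst (All (_≤ K)) eq xs≤K))))
            (subst (1 ≤_) (trans n-1-d≡ (sym (length-rc K rs)))
              (m<n⇒0<n∸m (∸-monoˡ-≤ 1 (2+≤ {n} 1≤d d≤)))))
    where
    n-1-d≡ : n ∸ 1 ∸ length ls ≡ length rs
    n-1-d≡ = trans (cong (λ k → k ∸ 1 ∸ length ls)
        (trans (sym (size perm)) (trans (cong length eq) (trans (length-++ ls) (+-suc _ _)))))
      (m+n∸m≡n (length ls) (length rs))

-- The theorem for indecomposable words

L′-irreducible-code : ∀ {n c} p → semilength p ≡ n → code p ≡ c →
  L′-irreducible p ≡ decode n (map (n ∸_) (complement n (map (_∸ 1) (proj₁ c))) ,
                               map (n ∸ 1 ∸_) (complement n (proj₂ c)))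
L′-irreducible-code p refl refl = refl

decode-IntervalPerm : ∀ {b n x xs} → IntervalPerm b n (x ∷ xs) →
  decode n (minimaCode (suc (b + n)) x xs) ≡ minimaPath (suc (b + n)) (x ∷ xs)
decode-IntervalPerm {b} {n} {x} {xs} π =
  decode-minimaPath x xs (s≤s (All.head (below π)))
    (trans (cong (suc (b + n) ∸_) (minimum-IntervalPerm π)) (m+n∸m≡n b n)) (size π)

semilength-IntervalPerm : ∀ {b n xs} → IntervalPerm b n xs → semilength (minimaPath (suc (b + n)) xs) ≡ n
semilength-IntervalPerm {b} {n} {xs} π = +-cancelʳ-≡ (suc b) _ _
  (trans (cong (semilength (minimaPath (suc (b + n)) xs) +_) (sym (minimum-IntervalPerm π)))
  (trans (semilength-minimaPath (suc (b + n)) xs) (trans (cong suc (+-comm b n)) (sym (+-suc n b)))))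

-- The reflected word lies on the `n` values after `K ∸ suc (b + n)`; its starting minimum, one
-- above the top value, is thus `K ∸ b`.
reflected-top : ∀ {b n K} → b + n < K → suc (K ∸ suc (b + n) + n) ≡ K ∸ b
reflected-top {b} {n} {K} b+n<K = begin
  suc (K ∸ suc (b + n) + n)    ≡⟨ +-suc (K ∸ suc (b + n)) n ⟨
  K ∸ suc (b + n) + suc n      ≡⟨ cong (λ k → K ∸ k + suc n) (+-suc b n) ⟨
  K ∸ (b + suc n) + suc n      ≡⟨ cong (_+ suc n) (∸-+-assoc K b (suc n)) ⟨
  K ∸ b ∸ suc n + suc n        ≡⟨ m∸n+n≡m (m+n≤o⇒m≤o∸n (suc n) (subst (_≤ K) (cong suc (+-comm b n)) b+n<K)) ⟩
  K ∸ b                        ∎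
  where open ≡-Reasoning

-- The path of the reflected word is the decoding of its own code, so only codes have to agree; all
-- four lists involved are strictly increasing, which leaves the comparison of their elements.
irreducible-case : ∀ {b n x xs} K → IntervalPerm b n (x ∷ xs) → b + n < K →
  Avoids (x ∷ xs) → Irreducible (x ∷ xs) →
  minimaPath (K ∸ b) (reverseComplement K (x ∷ xs)) ≡ L′-irreducible (minimaPath (suc (b + n)) (x ∷ xs))
irreducible-case {b} {n} {x} {xs} K π b+n<K avoids irr
  with reverseComplement K (x ∷ xs) in rc≡ | IntervalPerm-rc K b+n<K π
... | []     | π′ with () ← trans (size π) (sym (size π′))
... | y ∷ ys | π′ = begin
  minimaPath (K ∸ b) (y ∷ ys)
    ≡⟨ cong (λ m → minimaPath m (y ∷ ys)) (reflected-top b+n<K) ⟨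
  minimaPath (suc (K ∸ suc (b + n) + n)) (y ∷ ys)
    ≡⟨ decode-IntervalPerm π′ ⟨
  decode n (minimaCode (suc (K ∸ suc (b + n) + n)) y ys)
    ≡⟨ cong (λ m → decode n (minimaCode m y ys)) (reflected-top b+n<K) ⟩
  decode n (minimaCode (K ∸ b) y ys)
    ≡⟨ cong (decode n) (cong₂ _,_ values≡ positions≡) ⟩
  decode n (map (n ∸_) (complement n (map (_∸ 1) (proj₁ c))) ,
            map (n ∸ 1 ∸_) (complement n (proj₂ c)))
    ≡⟨ L′-irreducible-code (minimaPath (suc (b + n)) (x ∷ xs))
         (semilength-IntervalPerm π) (code-minimaPath x xs (s≤s (All.head (below π)))) ⟨
  L′-irreducible (minimaPath (suc (b + n)) (x ∷ xs)) ∎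
  where
  open ≡-Reasoning

  c = minimaCode (suc (b + n)) x xs

  y≤ : y ≤ K ∸ b
  y≤ = subst (y ≤_) (reflected-top b+n<K) (m≤n⇒m≤1+n (All.head (below π′)))

  values≡ : map (K ∸ b ∸_) (formerMinima y ys) ≡ map (n ∸_) (complement n (map (_∸ 1) (proj₁ c)))
  values≡ = sorted-ext (formerMinima-sorted ys y≤) (complement-sorted {n} {n} _ (m∸n≤m n 2))
    (λ e∈ → let u , u∈ , e≡ = ∈-map⁻ (K ∸ b ∸_) e∈ in
            subst (_∈ map (n ∸_) (complement n (map (_∸ 1) (proj₁ c)))) (sym e≡)
              (values⇒ K π b+n<K avoids irr rc≡ u∈))
    (values⇐ K π b+n<K avoids irr rc≡)

  positions≡ : minimaPositions y 1 ys ≡ map (n ∸ 1 ∸_) (complement n (proj₂ c))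
  positions≡ = sorted-ext (minimaPositions-sorted y 1 ys) (complement-sorted {n ∸ 1} {n} _ (∸-monoʳ-≤ n (s≤s z≤n)))
    (positions⇒ K π b+n<K avoids irr rc≡) (positions⇐ K π b+n<K avoids irr rc≡)

-- Decomposition into skew components

take-length-++ : ∀ (xs : List A) ys → take (length xs) (xs ++ ys) ≡ xs
take-length-++ []       ys = refl
take-length-++ (x ∷ xs) ys = cong (x ∷_) (take-length-++ xs ys)

drop-length-++ : ∀ (xs : List A) ys → drop (length xs) (xs ++ ys) ≡ ys
drop-length-++ []       ys = refl
drop-length-++ (x ∷ xs) ys = drop-length-++ xs ys

-- A finite search over the cuts: `i` letters of the tail go to the left part, and `i < length xs`
-- keeps the right part nonempty.
irreducible? : ∀ xs → Irreducible xs ⊎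
  ∃₂ λ y π → ∃₂ λ z τ → xs ≡ (y ∷ π) ++ z ∷ τ × Skew (y ∷ π) (z ∷ τ)
irreducible? [] = inj₁ λ _ _ _ _ ()
irreducible? (x ∷ xs) with anyUpTo? (λ i → all? (λ v → all? (v <?_) (x ∷ take i xs)) (drop i xs)) (length xs)
... | yes (i , i< , skew) with drop i xs | take++drop≡id i xs | skew
...   | []    | eq | _ = contradiction i<
                           (≤⇒≯ (subst (_≤ i) (trans (sym (length-take i xs))
                             (cong length (trans (sym (++-identityʳ _)) eq))) (m⊓n≤m i _)))
...   | z ∷ τ | eq | skew′ = inj₂ (x , take i xs , z , τ , cong (x ∷_) (sym eq) ,
                               λ u v u∈ v∈ → All.lookup (All.lookup skew′ v∈) u∈)
irreducible? (x ∷ xs) | no ¬skew = inj₁ λ { _ π z τ refl skew → ¬skew (length π ,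
    subst (length π <_) (sym (length-++ π)) (subst (length π <_) (sym (+-suc _ _)) (s≤s (m≤m+n _ _))) ,
    subst₂ (λ γ δ → All (λ v → All (v <_) (x ∷ γ)) δ)
      (sym (take-length-++ π (z ∷ τ))) (sym (drop-length-++ π (z ∷ τ)))
      (All.tabulate λ v∈ → All.tabulate λ u∈ → skew _ _ u∈ v∈)) }

-- The first component of the left part of a skew sum is the first component of the whole. The left
-- part is shorter but not a subterm, hence the bound `k`.
firstComponent : ∀ k x xs → length xs < k →
  ∃₂ λ π δ → x ∷ xs ≡ (x ∷ π) ++ δ × Irreducible (x ∷ π) × Skew (x ∷ π) δ
firstComponent (suc k) x xs (s≤s len≤) with irreducible? (x ∷ xs)
... | inj₁ irr = xs , [] , cong (x ∷_) (sym (++-identityʳ xs)) , irr , λ _ _ _ ()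
... | inj₂ (_ , π , z , τ , refl , skew)
  with π′ , δ , eq , irr , skew′ ← firstComponent k x π
         (<-≤-trans (subst (length π <_) (sym (trans (length-++ π) (+-suc _ _))) (s≤s (m≤m+n _ _))) len≤) =
  π′ , δ ++ z ∷ τ , trans (cong (_++ z ∷ τ) eq) (++-assoc (x ∷ π′) δ (z ∷ τ)) , irr , skew″
  where
  skew″ : Skew (x ∷ π′) (δ ++ z ∷ τ)
  skew″ u v u∈ v∈ with ∈-++⁻ δ v∈
  ... | inj₁ v∈δ = skew′ u v u∈ v∈δ
  ... | inj₂ v∈τ = skew u v (subst (u ∈_) (sym eq) (∈-++⁺ˡ u∈)) v∈τ

Avoids-++⁻ˡ : ∀ γ {δ} → Avoids (γ ++ δ) → Avoids γ
Avoids-++⁻ˡ γ avoids ys z zs refl x∈ y∈ = avoids ys z _ (++-assoc ys (z ∷ zs) _) x∈ (∈-++⁺ˡ y∈)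

Avoids-++⁻ʳ : ∀ γ {δ} → Avoids (γ ++ δ) → Avoids δ
Avoids-++⁻ʳ γ avoids ys z zs refl x∈ y∈ =
  avoids (γ ++ ys) z zs (sym (++-assoc γ ys (z ∷ zs))) (∈-++⁺ʳ γ x∈) y∈

L′-∷ : ∀ {P p q} → components p ≡ P ∷ components q → L′ p ≡ L′ q ++ L′-irreducible P
L′-∷ {P} {p} {q} eq = begin
  concatMap L′-irreducible (reverse (components p))
    ≡⟨ cong (λ Ps → concatMap L′-irreducible (reverse Ps)) eq ⟩
  concatMap L′-irreducible (reverse (P ∷ components q))
    ≡⟨ cong (concatMap L′-irreducible) (unfold-reverse P (components q)) ⟩
  concatMap L′-irreducible (reverse (components q) ++ [ P ])
    ≡⟨ concatMap-++ L′-irreducible (reverse (components q)) [ P ] ⟩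
  L′ q ++ L′-irreducible P ++ []
    ≡⟨ cong (L′ q ++_) (++-identityʳ _) ⟩
  L′ q ++ L′-irreducible P ∎
  where open ≡-Reasoning

-- Induction peels off the first component. It occupies the upper values, so its path ends at the
-- running minimum `suc (b + d)` from which the path of `δ` starts; its reflection comes last, and
-- so does its image under L′.
minimaPath-rc : ∀ k {b n} K xs → length xs ≤ k → IntervalPerm b n xs → b + n < K → Avoids xs →
  minimaPath (K ∸ b) (reverseComplement K xs) ≡ L′ (minimaPath (suc (b + n)) xs)
minimaPath-rc _ K [] _ _ _ _ = refl
minimaPath-rc (suc k) {b} {n} K (x ∷ xs) (s≤s len≤) perm b+n<K avoids
  with γ , δ , refl , irr , skew ← firstComponent _ x xs ≤-refl = begin
  minimaPath (K ∸ b) (rc ((x ∷ γ) ++ δ))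
    ≡⟨ cong (minimaPath (K ∸ b)) (rc-++ K (x ∷ γ) δ) ⟩
  minimaPath (K ∸ b) (rc δ ++ rc (x ∷ γ))
    ≡⟨ minimaPath-++ (K ∸ b) (rc δ) (rc (x ∷ γ)) ⟩
  minimaPath (K ∸ b) (rc δ) ++ minimaPath (minimum (K ∸ b) (rc δ)) (rc (x ∷ γ))
    ≡⟨ cong (λ m → minimaPath (K ∸ b) (rc δ) ++ minimaPath m (rc (x ∷ γ))) min-rc ⟩
  minimaPath (K ∸ b) (rc δ) ++ minimaPath (K ∸ (b + d)) (rc (x ∷ γ))
    ≡⟨ cong₂ _++_
         (minimaPath-rc k K δ (≤-trans (≤-trans (m≤n+m d (length γ)) (≤-reflexive (sym (length-++ γ)))) len≤)
            permˡ b+d<K (Avoids-++⁻ʳ (x ∷ γ) avoids))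
         (irreducible-case K permᵘ (subst (_< K) (sym total) b+n<K) (Avoids-++⁻ˡ (x ∷ γ) avoids) irr) ⟩
  L′ (minimaPath (suc (b + d)) δ) ++ L′-irreducible (minimaPath (suc (b + d + length (x ∷ γ))) (x ∷ γ))
    ≡⟨ cong (λ m → L′ (minimaPath (suc (b + d)) δ) ++ L′-irreducible (minimaPath (suc m) (x ∷ γ))) total ⟩
  L′ (minimaPath (suc (b + d)) δ) ++ L′-irreducible (minimaPath (suc (b + n)) (x ∷ γ))
    ≡⟨ L′-∷ {p = minimaPath (suc (b + n)) (x ∷ γ) ++ minimaPath (suc (b + d)) δ}
         {q = minimaPath (suc (b + d)) δ}
         (components-minimaPath 0 (suc (b + n)) x γ (minimaPath (suc (b + d)) δ) above′ final) ⟨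
  L′ (minimaPath (suc (b + n)) (x ∷ γ) ++ minimaPath (suc (b + d)) δ)
    ≡⟨ cong (λ m → L′ (minimaPath (suc (b + n)) (x ∷ γ) ++ minimaPath m δ)) min-γ ⟨
  L′ (minimaPath (suc (b + n)) (x ∷ γ) ++ minimaPath (minimum (suc (b + n)) (x ∷ γ)) δ)
    ≡⟨ cong L′ (minimaPath-++ (suc (b + n)) (x ∷ γ) δ) ⟨
  L′ (minimaPath (suc (b + n)) ((x ∷ γ) ++ δ)) ∎
  where
  open ≡-Reasoning
  rc = reverseComplement K
  d = length δ
  permˡ = IntervalPerm-lower (x ∷ γ) perm skew
  permᵘ = IntervalPerm-upper (x ∷ γ) perm skew
  total = skew-total (x ∷ γ) perm skew

  b+d<K : b + d < K
  b+d<K = ≤-<-trans (≤-trans (m≤m+n (b + d) (length (x ∷ γ))) (≤-reflexive total)) b+n<K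

  -- After the reflected lower part, the running minimum is the starting minimum of the reflected
  -- upper part, whose interval lies above `b + d`.
  min-rc : minimum (K ∸ b) (rc δ) ≡ K ∸ (b + d)
  min-rc = trans (cong (λ m → minimum m (rc δ)) (sym (reflected-top b+d<K)))
    (trans (minimum-IntervalPerm (IntervalPerm-rc K b+d<K permˡ)) (sym (+-∸-assoc 1 b+d<K)))

  min-γ : minimum (suc (b + n)) (x ∷ γ) ≡ suc (b + d)
  min-γ = trans (cong (λ m → minimum (suc m) (x ∷ γ)) (sym total)) (minimum-IntervalPerm permᵘ)

  above′ : ∀ y π z τ → x ∷ γ ≡ (y ∷ π) ++ z ∷ τ →
    minimum (suc (b + n)) (y ∷ π) + length (y ∷ π) < suc (b + n)
  above′ y π z τ eq = subst (λ t → minimum (suc t) (y ∷ π) + length (y ∷ π) < suc t) total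
    (irreducible⇒above permᵘ irr y π z τ eq)

  final : minimum (suc (b + n)) (x ∷ γ) + length (x ∷ γ) ≡ suc (b + n)
  final = trans (cong (_+ length (x ∷ γ)) min-γ) (cong suc total)

-- λ and μ as paths of minima

-- The invariant says that `m` tests for new minima as `seen` does. It is restricted to letters
-- below `M` because with nothing seen every letter passes, while `m` is still the starting value.
-- The letters `w` belong to the block already open and leave only D's.
lambdaFrom-minimaPath : ∀ {M m} seen xs → All (_< M) xs →
  (∀ {z} → z < M → (All (z <_) seen → z < m) × (z < m → All (z <_) seen)) →
  let w , mws = ltrMinFactorsFrom seen xs in
  replicate (length w) D ++ lambdaFrom m mws ≡ minimaPath m xs
lambdaFrom-minimaPath seen [] _ _ = refl
lambdaFrom-minimaPath {M} {m} seen (x ∷ xs) (x<M ∷ xs<M) inv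
  with ltrMinFactorsFrom (x ∷ seen) xs | lambdaFrom-minimaPath {M} {m ⊓ x} (x ∷ seen) xs xs<M
    (λ z<M → (λ { (z<x ∷ z<seen) → ⊓-glb (proj₁ (inv z<M) z<seen) z<x })
           , λ z<m⊓x → <-≤-trans z<m⊓x (m⊓n≤n m x)
                       ∷ proj₂ (inv z<M) (<-≤-trans z<m⊓x (m⊓n≤m m x)))
... | w , mws | ih with all? (x <?_) seen
...   | yes x<seen rewrite m≥n⇒m⊓n≡n (<⇒≤ (proj₁ (inv x<M) x<seen)) =
  cong (replicate (m ∸ x) U ++_)
    (trans (cong (λ k → replicate k D ++ lambdaFrom x mws) (+-comm (length w) 1)) (cong (D ∷_) ih))
...   | no ¬x<seen with m≤x ← ≮⇒≥ (λ x<m → ¬x<seen (proj₂ (inv x<M) x<m))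
  rewrite m≤n⇒m∸n≡0 m≤x | m≤n⇒m⊓n≡m m≤x = cong (D ∷_) ih

ltrMinFactors-leading : ∀ xs → proj₁ (ltrMinFactorsFrom [] xs) ≡ []
ltrMinFactors-leading []       = refl
ltrMinFactors-leading (x ∷ xs) = refl

lambda-minimaPath : ∀ {m} xs → All (_< m) xs → lambdaFrom m (ltrMinFactors xs) ≡ minimaPath m xs
lambda-minimaPath {m} xs xs<m =
  trans (cong (λ w → replicate (length w) D ++ lambdaFrom m (ltrMinFactors xs)) (sym (ltrMinFactors-leading xs)))
        (lambdaFrom-minimaPath [] xs xs<m (λ z<m → (λ _ → z<m) , λ _ → []))

-- The maximum from which `muFrom` measures the ascent of a block appended at the end.
lastMax : ℕ → List (List ℕ × ℕ) → ℕ
lastMax M₀ []              = M₀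
lastMax M₀ ((u , M) ∷ uMs) = lastMax M uMs

firstMax : ℕ → List (List ℕ × ℕ) → ℕ
firstMax M₀ []            = M₀
firstMax M₀ ((u , M) ∷ _) = M

lastMax-∷ʳ : ∀ M₀ uMs u M → lastMax M₀ (uMs ++ [ (u , M) ]) ≡ M
lastMax-∷ʳ M₀ []        u M = refl
lastMax-∷ʳ M₀ (_ ∷ uMs) u M = lastMax-∷ʳ _ uMs u M

lastMax-reverse : ∀ M₀ uMs → lastMax M₀ (reverse uMs) ≡ firstMax M₀ uMs
lastMax-reverse M₀ []              = refl
lastMax-reverse M₀ ((u , M) ∷ uMs) =
  trans (cong (lastMax M₀) (unfold-reverse (u , M) uMs)) (lastMax-∷ʳ M₀ (reverse uMs) u M)

muFrom-∷ʳ : ∀ M₀ uMs u M → muFrom M₀ (uMs ++ [ (u , M) ]) ≡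
  muFrom M₀ uMs ++ replicate (M ∸ lastMax M₀ uMs) U ++ replicate (length u + 1) D
muFrom-∷ʳ M₀ [] u M = cong (replicate (M ∸ M₀) U ++_) (++-identityʳ _)
muFrom-∷ʳ M₀ ((u′ , M′) ∷ uMs) u M = begin
  replicate (M′ ∸ M₀) U ++ replicate (length u′ + 1) D ++ muFrom M′ (uMs ++ [ (u , M) ])
    ≡⟨ cong (λ p → replicate (M′ ∸ M₀) U ++ replicate (length u′ + 1) D ++ p) (muFrom-∷ʳ M′ uMs u M) ⟩
  replicate (M′ ∸ M₀) U ++ replicate (length u′ + 1) D ++ muFrom M′ uMs ++ end
    ≡⟨ cong (replicate (M′ ∸ M₀) U ++_) (++-assoc (replicate (length u′ + 1) D) _ _) ⟨
  replicate (M′ ∸ M₀) U ++ (replicate (length u′ + 1) D ++ muFrom M′ uMs) ++ end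
    ≡⟨ ++-assoc (replicate (M′ ∸ M₀) U) _ _ ⟨
  muFrom M₀ ((u′ , M′) ∷ uMs) ++ end ∎
  where
  open ≡-Reasoning
  end = replicate (M ∸ lastMax M′ uMs) U ++ replicate (length u + 1) D

-- Factors accumulate at the front of the list as letters are put before the word, while μ reads the
-- list backwards, so a new factor extends the path at its end.
muFrom-reverse : ∀ M₀ u M uMs → muFrom M₀ (reverse ((u , M) ∷ uMs)) ≡
  muFrom M₀ (reverse uMs) ++ replicate (M ∸ firstMax M₀ uMs) U ++ replicate (length u + 1) D
muFrom-reverse M₀ u M uMs =
  trans (cong (muFrom M₀) (unfold-reverse (u , M) uMs))
  (trans (muFrom-∷ʳ M₀ (reverse uMs) u M)
         (cong (λ m → muFrom M₀ (reverse uMs) ++ replicate (M ∸ m) U ++ replicate (length u + 1) D)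
               (lastMax-reverse M₀ uMs)))

muFrom-consWord : ∀ M₀ x uM uMs →
  muFrom M₀ (reverse (consWord x (uM ∷ uMs))) ≡ muFrom M₀ (reverse (uM ∷ uMs)) ++ [ D ]
muFrom-consWord M₀ x (u , M) uMs = begin
  muFrom M₀ (reverse ((x ∷ u , M) ∷ uMs))
    ≡⟨ muFrom-reverse M₀ (x ∷ u) M uMs ⟩
  front ++ ups ++ replicate (suc (length u + 1)) D
    ≡⟨ cong (λ p → front ++ ups ++ p)
         (trans (cong (λ k → replicate k D) (+-comm 1 (length u + 1))) (replicate-+ (length u + 1) 1 D)) ⟩
  front ++ ups ++ replicate (length u + 1) D ++ [ D ]
    ≡⟨ cong (front ++_) (++-assoc ups _ _) ⟨
  front ++ (ups ++ replicate (length u + 1) D) ++ [ D ]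
    ≡⟨ ++-assoc front _ _ ⟨
  (front ++ ups ++ replicate (length u + 1) D) ++ [ D ]
    ≡⟨ cong (_++ [ D ]) (muFrom-reverse M₀ u M uMs) ⟨
  muFrom M₀ (reverse ((u , M) ∷ uMs)) ++ [ D ] ∎
  where
  open ≡-Reasoning
  front = muFrom M₀ (reverse uMs)
  ups = replicate (M ∸ firstMax M₀ uMs) U

rtlMaxFactors-∷ : ∀ x xs → ∃₂ λ uM uMs → rtlMaxFactors (x ∷ xs) ≡ uM ∷ uMs
rtlMaxFactors-∷ x xs with all? (_<? x) xs
... | yes _ = _ , _ , refl
rtlMaxFactors-∷ x []        | no ¬p = contradiction [] ¬p
rtlMaxFactors-∷ x (x′ ∷ xs) | no _ with rtlMaxFactors (x′ ∷ xs) | rtlMaxFactors-∷ x′ xs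
... | _ | _ , _ , refl = _ , _ , refl

maximum : ℕ → List ℕ → ℕ
maximum = foldr _⊔_

maximum-≥ : ∀ b {x xs} → x ∈ xs → x ≤ maximum b xs
maximum-≥ b {xs = x ∷ xs} (here refl) = m≤m⊔n x _
maximum-≥ b {xs = x ∷ xs} (there x∈)  = ≤-trans (maximum-≥ b x∈) (m≤n⊔m x _)

maximum-≤ : ∀ {b x xs} → b ≤ x → All (_≤ x) xs → maximum b xs ≤ x
maximum-≤ b≤x []           = b≤x
maximum-≤ b≤x (y≤x ∷ ys≤x) = ⊔-lub y≤x (maximum-≤ b≤x ys≤x)

firstMax-consWord : ∀ b x uMs → firstMax b (consWord x uMs) ≡ firstMax b uMs
firstMax-consWord b x []      = refl
firstMax-consWord b x (_ ∷ _) = refl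

not-maximum : ∀ b {x} xs → ¬ All (_< x) xs → x ≤ maximum b xs
not-maximum b {x} xs ¬xs<x with y , y∈ , y≮x ← find (¬All⇒Any¬ (_<? x) xs ¬xs<x) =
  ≤-trans (≮⇒≥ y≮x) (maximum-≥ b y∈)

firstMax-rtl : ∀ {b xs} → All (b ≤_) xs → firstMax b (rtlMaxFactors xs) ≡ maximum b xs
firstMax-rtl [] = refl
firstMax-rtl {b} {x ∷ xs} (b≤x ∷ b≤xs) with all? (_<? x) xs
... | yes xs<x = sym (m≥n⇒m⊔n≡m (maximum-≤ b≤x (All.map <⇒≤ xs<x)))
... | no ¬xs<x = trans (firstMax-consWord b x (rtlMaxFactors xs))
                   (trans (firstMax-rtl b≤xs) (sym (m≤n⇒m⊔n≡n (not-maximum b xs ¬xs<x))))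

minimum-rc : ∀ K b xs → minimum (K ∸ b) (reverseComplement K xs) ≡ K ∸ maximum b xs
minimum-rc K b []       = refl
minimum-rc K b (x ∷ xs) = begin
  minimum (K ∸ b) (reverseComplement K xs ++ [ K ∸ x ])
    ≡⟨ foldl-∷ʳ _⊓_ (K ∸ b) (K ∸ x) (reverseComplement K xs) ⟩
  minimum (K ∸ b) (reverseComplement K xs) ⊓ (K ∸ x)
    ≡⟨ cong (_⊓ (K ∸ x)) (minimum-rc K b xs) ⟩
  (K ∸ maximum b xs) ⊓ (K ∸ x)
    ≡⟨ ⊓-comm (K ∸ maximum b xs) (K ∸ x) ⟩
  (K ∸ x) ⊓ (K ∸ maximum b xs)
    ≡⟨ ∸-distribˡ-⊔-⊓ K x (maximum b xs) ⟨
  K ∸ maximum b (x ∷ xs) ∎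
  where open ≡-Reasoning

-- Putting `x` before the word puts `K ∸ x` after its reflection, and both paths gain the same steps
-- at the end: `x ∸ maximum b xs` up steps, none unless `x` is a new maximum, and one down step.
mu-minimaPath : ∀ K {b xs} → All (b ≤_) xs → All (_≤ K) xs →
  muFrom b (reverse (rtlMaxFactors xs)) ≡ minimaPath (K ∸ b) (reverseComplement K xs)
mu-minimaPath K [] [] = refl
mu-minimaPath K {b} {x ∷ xs} (b≤x ∷ b≤xs) (x≤K ∷ xs≤K) = begin
  muFrom b (reverse (rtlMaxFactors (x ∷ xs)))
    ≡⟨ step ⟩
  muFrom b (reverse (rtlMaxFactors xs)) ++ replicate (x ∸ maximum b xs) U ++ [ D ]
    ≡⟨ cong₂ (λ p k → p ++ replicate k U ++ [ D ]) (mu-minimaPath K b≤xs xs≤K) (sym exponent) ⟩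
  minimaPath (K ∸ b) rc ++ minimaPath (minimum (K ∸ b) rc) [ K ∸ x ]
    ≡⟨ minimaPath-++ (K ∸ b) rc [ K ∸ x ] ⟨
  minimaPath (K ∸ b) (rc ++ [ K ∸ x ]) ∎
  where
  open ≡-Reasoning
  rc = reverseComplement K xs

  exponent : minimum (K ∸ b) rc ∸ (K ∸ x) ≡ x ∸ maximum b xs
  exponent = begin
    minimum (K ∸ b) rc ∸ (K ∸ x)   ≡⟨ cong (_∸ (K ∸ x)) (minimum-rc K b xs) ⟩
    K ∸ maximum b xs ∸ (K ∸ x)     ≡⟨ ∸-swap K (maximum b xs) (K ∸ x) ⟩
    K ∸ (K ∸ x) ∸ maximum b xs     ≡⟨ cong (_∸ maximum b xs) (m∸[m∸n]≡n x≤K) ⟩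
    x ∸ maximum b xs               ∎

  step : muFrom b (reverse (rtlMaxFactors (x ∷ xs))) ≡
         muFrom b (reverse (rtlMaxFactors xs)) ++ replicate (x ∸ maximum b xs) U ++ [ D ]
  step with all? (_<? x) xs
  ... | yes _ = trans (muFrom-reverse b [] x (rtlMaxFactors xs))
          (cong (λ m → muFrom b (reverse (rtlMaxFactors xs)) ++ replicate (x ∸ m) U ++ [ D ])
                (firstMax-rtl b≤xs))
  -- Here the subtraction truncates to 0 and `x` joins the word of the first factor, which is the
  -- last block of the path.
  ... | no ¬xs<x rewrite m≤n⇒m∸n≡0 (not-maximum b xs ¬xs<x) = snoc xs ¬xs<x
    where
    snoc : ∀ xs → ¬ All (_< x) xs →
      muFrom b (reverse (consWord x (rtlMaxFactors xs))) ≡ muFrom b (reverse (rtlMaxFactors xs)) ++ [ D ]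
    snoc []        ¬p = contradiction [] ¬p
    snoc (x′ ∷ xs) _  with rtlMaxFactors (x′ ∷ xs) | rtlMaxFactors-∷ x′ xs
    ... | _ | uM , uMs , refl = muFrom-consWord b x uM uMs

-- Permutations as words

tabulate-split : ∀ {n} (f : Fin n → A) ys z zs → tabulate f ≡ ys ++ z ∷ zs →
  ∃ λ j → z ≡ f j × (∀ {x} → x ∈ ys → ∃ λ i → i Fin.< j × x ≡ f i)
                  × (∀ {y} → y ∈ zs → ∃ λ k → j Fin.< k × y ≡ f k)
tabulate-split {n = suc n} f [] z zs refl = zero , refl , (λ ()) , λ y∈ →
  let k , y≡ = ∈-tabulate⁻ y∈ in suc k , s≤s z≤n , y≡
tabulate-split {n = suc n} f (y ∷ ys) z zs eq with refl , eq′ ← ∷-injective eq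
  with j , z≡ , before , after ← tabulate-split (λ i → f (suc i)) ys z zs eq′ =
  suc j , z≡ ,
  (λ { (here refl) → zero , s≤s z≤n , refl
     ; (there x∈)  → let i , i<j , x≡ = before x∈ in suc i , s≤s i<j , x≡ }) ,
  λ y∈ → let k , j<k , y≡ = after y∈ in suc k , s≤s j<k , y≡

oneLine-IntervalPerm : ∀ {n} (σ : Permutation′ n) → IntervalPerm 0 n (oneLine σ)
oneLine-IntervalPerm σ = record
  { unique = Unique.tabulate⁺ λ {i} {j} eq →
      trans (sym (inverseˡ σ)) (trans (cong (σ ⟨$⟩ˡ_) (toℕ-injective (suc-injective eq))) (inverseˡ σ))
  ; above  = All.tabulate⁺ λ i → s≤s z≤n
  ; below  = All.tabulate⁺ λ i → toℕ<n (σ ⟨$⟩ʳ i)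
  ; size   = length-tabulate _
  }

oneLine-Avoids : ∀ {n} (σ : Permutation′ n) → Avoids123 σ → Avoids (oneLine σ)
oneLine-Avoids σ avoids ys z zs eq x∈ y∈ x<z z<y
  with j , refl , before , after ← tabulate-split _ ys z zs eq
  with i , i<j , refl ← before x∈ | k , j<k , refl ← after y∈ =
  avoids i j k i<j j<k (≤-pred x<z , ≤-pred z<y)

theorem6 : (n : ℕ) → 1 ≤ n → (σ : Permutation′ n) → Avoids123 σ →
    mu σ ≡ L′ (lambda σ)
theorem6 n _ σ avoids = begin
  mu σ
    -- With `b = 0` and `K = suc n` the reflection is the usual complement of letters in {1, ...,
    -- n}.
    ≡⟨ mu-minimaPath (suc n) (All.map <⇒≤ (above π)) (All.map m≤n⇒m≤1+n (below π)) ⟩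
  minimaPath (suc n) (reverseComplement (suc n) (oneLine σ))
    ≡⟨ minimaPath-rc _ (suc n) (oneLine σ) ≤-refl π ≤-refl (oneLine-Avoids σ avoids) ⟩
  L′ (minimaPath (suc n) (oneLine σ))
    ≡⟨ cong L′ (lambda-minimaPath (oneLine σ) (All.map s≤s (below π))) ⟨
  L′ (lambdaFrom (suc n) (ltrMinFactors (oneLine σ)))
    ≡⟨ cong (λ m → L′ (lambdaFrom m (ltrMinFactors (oneLine σ)))) (+-comm 1 n) ⟩
  L′ (lambda σ) ∎
  where
  open ≡-Reasoning
  π = oneLine-IntervalPerm σ
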